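{- Let $(a_j)_{j\in\mathbb{Z}}$ be an arbitrary sequence of integers with $a_j\geq 2$, and let $\lambda=(\lambda_1,\dots,\lambda_h)$ be a partition with conjugate $\lambda'=(\lambda'_1,\dots,\lambda'_{\lambda_1})$. Then the following identity of polynomials in $t$ holds: $$\det\Big(\zeta^{1-t}\big(a_{1-j},a_{2-j},\dots,a_{(\lambda_i+j-i)-j}\big)\Big)_{1\leq i,j\leq h}=\det\Big(\zeta^t\big(a_{j-1},a_{j-2},\dots,a_{j-(\lambda'_i+j-i)}\big)\Big)_{1\leq i,j\leq\lambda_1}.$$ Here the $(i,j)$ entry on the left has $\lambda_i+j-i$ arguments and the $(i,j)$ entry on the right has $\lambda'_i+j-i$ arguments; an entry is set to be $1$ if its number of arguments is $0$, and $0$ if its number of arguments is negative.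
   Context: A partition is a tuple $\lambda=(\lambda_1,\dots,\lambda_h)$ of integers with $\lambda_1\geq\dots\geq\lambda_h\geq 1$. Its conjugate $\lambda'=(\lambda'_1,\dots,\lambda'_{\lambda_1})$ is given by $\lambda'_j=\#\{i\mid\lambda_i\geq j\}$. For integers $k_1,\dots,k_{r-1}\geq 1$, $k_r\geq 2$, the interpolated multiple zeta value is the polynomial in $t$ $$\zeta^t(k_1,\dots,k_r)=\sum_{0<m_1\leq\dots\leq m_r}\frac{t^{e(m_1,\dots,m_r)}}{m_1^{k_1}\cdots m_r^{k_r}}\in\mathbb{R}[t],\qquad e(m_1,\dots,m_r)=\#\{1\leq i\leq r-1\mid m_i=m_{i+1}\},$$ and $\zeta^{1-t}(k_1,\dots,k_r)$ is obtained from it by substituting $1-t$ for $t$. -}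

module Defs where

open import Algebra.Bundles.Raw using (RawRing)
import Algebra.Definitions.RawMonoid as RawMonoidDefinitions
import Algebra.Definitions.RawSemiring as RawSemiringDefinitions
open import Data.Bool.Base using (true; false)
open import Data.Fin.Base using (Fin; toℕ; punchIn)
import Data.Fin.Base as Fin
open import Data.Integer.Base using (ℤ; +_; -[1+_])
import Data.Integer.Base as ℤ
import Data.Integer.Properties as ℤ
open import Data.List.Base using (List; []; _∷_; _++_)
import Data.List.Base as List
import Data.List.Properties as List
open import Data.Nat.Base using (ℕ; zero; suc; z≤n; s≤s)
import Data.Nat.Base as ℕ
import Data.Nat.Properties as ℕ
import Data.Nat.Solver as ℕ
open import Data.Product.Base using (∃; _×_; _,_; proj₁; proj₂; uncurry)
open import Data.Rational.Base
  using (ℚ; 0ℚ; 1ℚ; ½; _+_; _*_; _-_; -_; ∣_∣; _≤_; _<_; _/_; toℚᵘ; mkℚ; *<*)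
import Data.Rational.Base as ℚ
open import Data.Rational.Properties
open import Data.Rational.Solver using (module +-*-Solver)
open import Data.Rational.Unnormalised.Base using (mkℚᵘ)
import Data.Rational.Unnormalised.Base as ℚᵘ
import Data.Rational.Unnormalised.Properties as ℚᵘ
open import Data.Vec.Base using (Vec; []; _∷_; _∷ʳ_; count; foldr′; init; initLast; last; tail; zip; zipWith)
import Data.Vec.Base as Vec
open import Data.Vec.Functional using (Vector)
open import Data.Vec.Relation.Unary.All using (All; []; _∷_)
import Data.Vec.Relation.Unary.All as All
import Data.Vec.Relation.Unary.All.Properties as All
open import Data.Vec.Relation.Unary.Linked using (Linked)
open import Data.Sum.Base using (_⊎_; inj₁; inj₂)
open import Function.Base using (_∘_)
open import Level using (Level; 0ℓ)
open import Relation.Binary.PropositionalEquality.Core using (_≡_; refl; sym; trans; cong; cong₂; subst; subst₂)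
open import Relation.Nullary.Decidable.Core using (does)
open import Relation.Unary using (Pred; Decidable)

private module ℕSolver = ℕ.+-*-Solver
open +-*-Solver using (solve; _:=_; _:+_; _:*_; _:-_; :-_; con)

-- The value at 0 is junk and is never used.
recip : ℕ → ℚ
recip zero    = 0ℚ
recip (suc n) = + 1 / suc n

toℚᵘ-recip : ∀ n → toℚᵘ (recip (suc n)) ℚᵘ.≃ mkℚᵘ (+ 1) n
toℚᵘ-recip n = toℚᵘ-fromℚᵘ (mkℚᵘ (+ 1) n)

recip-pos : ∀ n → 0ℚ < recip (suc n)
recip-pos n = toℚᵘ-cancel-< (ℚᵘ.<-respʳ-≃ (ℚᵘ.≃-sym (toℚᵘ-recip n)) (ℚᵘ.*<* (ℤ.+<+ (s≤s z≤n))))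

recip-nonNeg : ∀ n → 0ℚ ≤ recip n
recip-nonNeg zero    = ≤-refl
recip-nonNeg (suc n) = <⇒≤ (recip-pos n)

recip-antimono : ∀ {m n} → 1 ℕ.≤ m → m ℕ.≤ n → recip n ≤ recip m
recip-antimono {suc m} {suc n} _ m≤n = toℚᵘ-cancel-≤
  (ℚᵘ.≤-respʳ-≃ (ℚᵘ.≃-sym (toℚᵘ-recip m)) (ℚᵘ.≤-respˡ-≃ (ℚᵘ.≃-sym (toℚᵘ-recip n))
    (ℚᵘ.*≤* (ℤ.*-monoˡ-≤-nonNeg (+ 1) (ℤ.+≤+ m≤n)))))

recip-* : ∀ m n → recip (m ℕ.* n) ≡ recip m * recip n
recip-* zero    n       = sym (*-zeroˡ (recip n))
recip-* (suc m) zero    = trans (cong recip (ℕ.*-zeroʳ m)) (sym (*-zeroʳ (recip (suc m))))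
recip-* (suc m) (suc n) = toℚᵘ-injective
  (ℚᵘ.≃-trans (toℚᵘ-recip (n ℕ.+ m ℕ.* suc n))
    (ℚᵘ.≃-sym (ℚᵘ.≃-trans (toℚᵘ-homo-* (recip (suc m)) (recip (suc n)))
      (ℚᵘ.*-cong (toℚᵘ-recip m) (toℚᵘ-recip n)))))

recip-telescope : ∀ n → recip (suc n) ≡ recip (suc (suc n)) + recip (suc n) * recip (suc (suc n))
recip-telescope n = toℚᵘ-injective (ℚᵘ.≃-trans (toℚᵘ-recip n) (ℚᵘ.≃-trans unnormalised (ℚᵘ.≃-sym
  (ℚᵘ.≃-trans (toℚᵘ-homo-+ (recip (suc (suc n))) (recip (suc n) * recip (suc (suc n))))
    (ℚᵘ.+-cong (toℚᵘ-recip (suc n))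
      (ℚᵘ.≃-trans (toℚᵘ-homo-* (recip (suc n)) (recip (suc (suc n))))
        (ℚᵘ.*-cong (toℚᵘ-recip n) (toℚᵘ-recip (suc n)))))))))
  where
  unnormalised : mkℚᵘ (+ 1) n ℚᵘ.≃ mkℚᵘ (+ 1) (suc n) ℚᵘ.+ mkℚᵘ (+ 1) n ℚᵘ.* mkℚᵘ (+ 1) (suc n)
  unnormalised = ℚᵘ.*≡* (cong +_ (ℕSolver.solve 1
    (λ x → let x+1 = ℕSolver.con 1 ℕSolver.:+ x ; x+2 = ℕSolver.con 2 ℕSolver.:+ x ; one = ℕSolver.con 1 in
      one ℕSolver.:* (x+2 ℕSolver.:* (x+1 ℕSolver.:* x+2)) ℕSolver.:=
      (one ℕSolver.:* (x+1 ℕSolver.:* x+2) ℕSolver.:+ one ℕSolver.:* x+2) ℕSolver.:* x+1) refl n))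

archimedean : ∀ C {ε} → 0ℚ < ε → ∃ λ K → ∀ n → K ℕ.≤ n → C * recip n < ε
archimedean C@(mkℚ c d _) {ε@(mkℚ (+ suc e) f _)} _ = suc (ℤ.∣ c ∣ ℕ.* suc f) , bound
  where
  bound : ∀ n → suc (ℤ.∣ c ∣ ℕ.* suc f) ℕ.≤ n → C * recip n < ε
  bound (suc n) K≤n = toℚᵘ-cancel-< (ℚᵘ.<-respˡ-≃
    (ℚᵘ.≃-sym (ℚᵘ.≃-trans (toℚᵘ-homo-* C (recip (suc n))) (ℚᵘ.*-congˡ {toℚᵘ C} (toℚᵘ-recip n))))
    (ℚᵘ.*<* (ℤ.≤-<-trans numerator (ℤ.+<+ denominator))))
    where
    i≤+∣i∣ : ∀ i → i ℤ.≤ + ℤ.∣ i ∣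
    i≤+∣i∣ (+ _)    = ℤ.≤-refl
    i≤+∣i∣ -[1+ _ ] = ℤ.-≤+

    numerator : (c ℤ.* + 1) ℤ.* + suc f ℤ.≤ + (ℤ.∣ c ∣ ℕ.* suc f)
    numerator = subst₂ ℤ._≤_ (cong (ℤ._* + suc f) (sym (ℤ.*-identityʳ c))) (sym (ℤ.pos-* ℤ.∣ c ∣ (suc f)))
      (ℤ.*-monoʳ-≤-nonNeg (+ suc f) (i≤+∣i∣ c))

    denominator : ℤ.∣ c ∣ ℕ.* suc f ℕ.< suc e ℕ.* (suc d ℕ.* suc n)
    denominator = ℕ.≤-trans K≤n (ℕ.≤-trans (ℕ.m≤n*m (suc n) (suc d)) (ℕ.m≤n*m (suc d ℕ.* suc n) (suc e)))
archimedean _ {mkℚ (+ zero) _ _} (*<* (ℤ.+<+ ()))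
archimedean _ {mkℚ -[1+ _ ] _ _} (*<* ())

0<1 : 0ℚ < 1ℚ
0<1 = positive⁻¹ 1ℚ

half-pos : ∀ {ε} → 0ℚ < ε → 0ℚ < ½ * ε
half-pos {ε} ε>0 = subst (_< ½ * ε) (*-zeroʳ ½) (*-monoʳ-<-pos ½ ε>0)

half+half : ∀ ε → ½ * ε + ½ * ε ≡ ε
half+half = solve 1 (λ ε → con ½ :* ε :+ con ½ :* ε := ε) refl

≤-+-nonNegʳ : ∀ p {q} → 0ℚ ≤ q → p ≤ p + q
≤-+-nonNegʳ p q≥0 = subst (_≤ p + _) (+-identityʳ p) (+-monoʳ-≤ p q≥0)

≤-+-nonNegˡ : ∀ p {q} → 0ℚ ≤ q → p ≤ q + p
≤-+-nonNegˡ p {q} q≥0 = subst (p ≤_) (+-comm p q) (≤-+-nonNegʳ p q≥0)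

*-mono-nonNeg : ∀ {p q r s} → 0ℚ ≤ p → p ≤ q → 0ℚ ≤ r → r ≤ s → p * r ≤ q * s
*-mono-nonNeg {p} {q} {r} {s} p≥0 p≤q r≥0 r≤s =
  ≤-trans (*-monoʳ-≤-nonNeg r {{ℚ.nonNegative r≥0}} p≤q)
          (*-monoˡ-≤-nonNeg q {{ℚ.nonNegative (≤-trans p≥0 p≤q)}} r≤s)

*-nonNeg : ∀ {p q} → 0ℚ ≤ p → 0ℚ ≤ q → 0ℚ ≤ p * q
*-nonNeg {p} {q} p≥0 q≥0 = subst (_≤ p * q) (*-zeroˡ q) (*-monoʳ-≤-nonNeg q {{ℚ.nonNegative q≥0}} p≥0)

IsCauchy : (ℕ → ℚ) → Set
IsCauchy x = ∀ ε → 0ℚ < ε → ∃ λ N → ∀ m n → N ℕ.≤ m → N ℕ.≤ n → ∣ x m - x n ∣ < ε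

record ℝ : Set where
  constructor mkℝ
  field
    seq    : ℕ → ℚ
    cauchy : IsCauchy seq

open ℝ public

-- All ring operations act termwise on representatives, and equality forgets
-- the Cauchy witness.
infix 4 _≈ℝ_
_≈ℝ_ : ℝ → ℝ → Set
x ≈ℝ y = ∀ ε → 0ℚ < ε → ∃ λ N → ∀ n → N ℕ.≤ n → ∣ seq x n - seq y n ∣ < ε

fromℚ : ℚ → ℝ
fromℚ q = mkℝ (λ _ → q) λ ε ε>0 → 0 , λ _ _ _ _ → subst (_< ε) (cong ∣_∣ (sym (+-inverseʳ q))) ε>0

+-cauchy : ∀ {x y} → IsCauchy x → IsCauchy y → IsCauchy (λ n → x n + y n)
+-cauchy {x} {y} x-cauchy y-cauchy ε ε>0
  with x-cauchy (½ * ε) (half-pos ε>0) | y-cauchy (½ * ε) (half-pos ε>0)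
... | M , xM | N , yN = M ℕ.⊔ N , λ m n M⊔N≤m M⊔N≤n → begin-strict
  ∣ (x m + y m) - (x n + y n) ∣     ≡⟨ cong ∣_∣ (regroup (x m) (y m) (x n) (y n)) ⟩
  ∣ (x m - x n) + (y m - y n) ∣     ≤⟨ ∣p+q∣≤∣p∣+∣q∣ (x m - x n) (y m - y n) ⟩
  ∣ x m - x n ∣ + ∣ y m - y n ∣     <⟨ +-mono-< (xM m n (ℕ.m⊔n≤o⇒m≤o M N M⊔N≤m) (ℕ.m⊔n≤o⇒m≤o M N M⊔N≤n))
                                                (yN m n (ℕ.m⊔n≤o⇒n≤o M N M⊔N≤m) (ℕ.m⊔n≤o⇒n≤o M N M⊔N≤n)) ⟩
  ½ * ε + ½ * ε                     ≡⟨ half+half ε ⟩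
  ε                                 ∎
  where
  open ≤-Reasoning
  regroup : ∀ a b c d → (a + b) - (c + d) ≡ (a - c) + (b - d)
  regroup = solve 4 (λ a b c d → (a :+ b) :- (c :+ d) := (a :- c) :+ (b :- d)) refl

neg-cauchy : ∀ {x} → IsCauchy x → IsCauchy (λ n → - x n)
neg-cauchy {x} x-cauchy ε ε>0 with x-cauchy ε ε>0
... | N , xN = N , λ m n N≤m N≤n → subst (_< ε)
  (trans (sym (∣-p∣≡∣p∣ (x m - x n))) (cong ∣_∣ (regroup (x m) (x n)))) (xN m n N≤m N≤n)
  where
  regroup : ∀ a b → - (a - b) ≡ - a - - b
  regroup = solve 2 (λ a b → :- (a :- b) := :- a :- (:- b)) refl

cauchy-bounded : ∀ {x} → IsCauchy x → ∃ λ B → 0ℚ ≤ B × ∃ λ N → ∀ n → N ℕ.≤ n → ∣ x n ∣ ≤ B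
cauchy-bounded {x} x-cauchy with x-cauchy 1ℚ 0<1
... | N , xN = 1ℚ + ∣ x N ∣ , ≤-trans (0≤∣p∣ (x N)) (≤-+-nonNegˡ ∣ x N ∣ (<⇒≤ 0<1)) ,
  N , λ n N≤n → begin
    ∣ x n ∣                   ≡⟨ cong ∣_∣ (regroup (x n) (x N)) ⟩
    ∣ (x n - x N) + x N ∣     ≤⟨ ∣p+q∣≤∣p∣+∣q∣ (x n - x N) (x N) ⟩
    ∣ x n - x N ∣ + ∣ x N ∣   ≤⟨ +-monoˡ-≤ ∣ x N ∣ (<⇒≤ (xN n N N≤n ℕ.≤-refl)) ⟩
    1ℚ + ∣ x N ∣              ∎
  where
  open ≤-Reasoning
  regroup : ∀ a b → a ≡ (a - b) + b
  regroup = solve 2 (λ a b → a := (a :- b) :+ b) refl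

shrink : ∀ B {ε} → 0ℚ < ε → ∃ λ δ → 0ℚ < δ × B * δ < ε
shrink B ε>0 with archimedean B ε>0
... | K , small = recip (suc K) , recip-pos K , small (suc K) (ℕ.n≤1+n K)

*-cauchy : ∀ {x y} → IsCauchy x → IsCauchy y → IsCauchy (λ n → x n * y n)
*-cauchy {x} {y} x-cauchy y-cauchy ε ε>0 =
  let B , B≥0 , K , xB = cauchy-bounded {x} x-cauchy
      C , C≥0 , L , yC = cauchy-bounded {y} y-cauchy
      δ , δ>0 , Bδ     = shrink B (half-pos ε>0)
      η , η>0 , Cη     = shrink C (half-pos ε>0)
      M , yM           = y-cauchy δ δ>0
      N , xN           = x-cauchy η η>0
  in (K ℕ.⊔ L) ℕ.⊔ (M ℕ.⊔ N) , λ m n p q →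
    let K⊔L≤m = ℕ.m⊔n≤o⇒m≤o (K ℕ.⊔ L) (M ℕ.⊔ N) p
        K⊔L≤n = ℕ.m⊔n≤o⇒m≤o (K ℕ.⊔ L) (M ℕ.⊔ N) q
        M⊔N≤m = ℕ.m⊔n≤o⇒n≤o (K ℕ.⊔ L) (M ℕ.⊔ N) p
        M⊔N≤n = ℕ.m⊔n≤o⇒n≤o (K ℕ.⊔ L) (M ℕ.⊔ N) q
    in estimate m n (xB m (ℕ.m⊔n≤o⇒m≤o K L K⊔L≤m)) (yC n (ℕ.m⊔n≤o⇒n≤o K L K⊔L≤n))
         (yM m n (ℕ.m⊔n≤o⇒m≤o M N M⊔N≤m) (ℕ.m⊔n≤o⇒m≤o M N M⊔N≤n))
         (xN m n (ℕ.m⊔n≤o⇒n≤o M N M⊔N≤m) (ℕ.m⊔n≤o⇒n≤o M N M⊔N≤n)) Bδ Cη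
  where
  open ≤-Reasoning
  regroup : ∀ a b c d → a * b - c * d ≡ a * (b - d) + d * (a - c)
  regroup = solve 4 (λ a b c d → a :* b :- c :* d := a :* (b :- d) :+ d :* (a :- c)) refl

  estimate : ∀ {B C δ η} m n → ∣ x m ∣ ≤ B → ∣ y n ∣ ≤ C → ∣ y m - y n ∣ < δ → ∣ x m - x n ∣ < η →
             B * δ < ½ * ε → C * η < ½ * ε → ∣ x m * y m - x n * y n ∣ < ε
  estimate {B} {C} {δ} {η} m n xB yC dy dx Bδ Cη = begin-strict
    ∣ x m * y m - x n * y n ∣                            ≡⟨ cong ∣_∣ (regroup (x m) (y m) (x n) (y n)) ⟩
    ∣ x m * (y m - y n) + y n * (x m - x n) ∣            ≤⟨ ∣p+q∣≤∣p∣+∣q∣ (x m * (y m - y n)) (y n * (x m - x n)) ⟩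
    ∣ x m * (y m - y n) ∣ + ∣ y n * (x m - x n) ∣        ≡⟨ cong₂ _+_ (∣p*q∣≡∣p∣*∣q∣ (x m) (y m - y n)) (∣p*q∣≡∣p∣*∣q∣ (y n) (x m - x n)) ⟩
    ∣ x m ∣ * ∣ y m - y n ∣ + ∣ y n ∣ * ∣ x m - x n ∣    ≤⟨ +-mono-≤ (*-mono-nonNeg (0≤∣p∣ (x m)) xB (0≤∣p∣ (y m - y n)) (<⇒≤ dy))
                                                                     (*-mono-nonNeg (0≤∣p∣ (y n)) yC (0≤∣p∣ (x m - x n)) (<⇒≤ dx)) ⟩
    B * δ + C * η                                        <⟨ +-mono-< Bδ Cη ⟩
    ½ * ε + ½ * ε                                        ≡⟨ half+half ε ⟩
    ε                                                    ∎

ℝ-rawRing : RawRing 0ℓ 0ℓ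
ℝ-rawRing = record
  { Carrier = ℝ
  ; _≈_     = _≈ℝ_
  ; _+_     = λ x y → mkℝ (λ n → seq x n + seq y n) (+-cauchy {seq x} {seq y} (cauchy x) (cauchy y))
  ; _*_     = λ x y → mkℝ (λ n → seq x n * seq y n) (*-cauchy {seq x} {seq y} (cauchy x) (cauchy y))
  ; -_      = λ x → mkℝ (λ n → - seq x n) (neg-cauchy {seq x} (cauchy x))
  ; 0#      = fromℚ 0ℚ
  ; 1#      = fromℚ 1ℚ
  }

-- All (m₁, …, mᵣ) with 0 < m₁ ≤ ⋯ ≤ mᵣ ≤ N, split according to whether
-- mᵣ < N or mᵣ = N.
weaklyIncreasing : ∀ (N r : ℕ) → List (Vec ℕ r)
weaklyIncreasing N       zero    = [] ∷ []
weaklyIncreasing zero    (suc r) = []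
weaklyIncreasing (suc N) (suc r) =
  weaklyIncreasing N (suc r) ++ List.map (_∷ʳ suc N) (weaklyIncreasing (suc N) r)

equalities : ∀ {r} → Vec ℕ (suc r) → ℕ
equalities m = count {P = uncurry _≡_} (uncurry ℕ._≟_) (zip (init m) (tail m))

-- 1 / (m₁^k₁ ⋯ mᵣ^kᵣ)
summand : ∀ {r} → Vec ℕ r → Vec ℕ r → ℚ
summand k m = recip (foldr′ ℕ._*_ 1 (zipWith ℕ._^_ m k))

sumℚ : List ℚ → ℚ
sumℚ = List.foldr _+_ 0ℚ

-- The coefficient of t^j in the sum defining ζᵗ(k), truncated to mᵣ ≤ N.
ζ-partial : ∀ {r} → Vec ℕ (suc r) → ℕ → ℕ → ℚ
ζ-partial {r} k j N =
  sumℚ (List.map (summand k) (List.filter (λ m → equalities m ℕ.≟ j) (weaklyIncreasing N (suc r))))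

Admissible : ∀ {r} → Vec ℕ (suc r) → Set
Admissible k = All (1 ℕ.≤_) (init k) × 2 ℕ.≤ last k

summand-nonNeg : ∀ {r} (k m : Vec ℕ r) → 0ℚ ≤ summand k m
summand-nonNeg k m = recip-nonNeg (foldr′ ℕ._*_ 1 (zipWith ℕ._^_ m k))

summand-∷ʳ : ∀ {r} (k m : Vec ℕ r) l n → summand (k ∷ʳ l) (m ∷ʳ n) ≡ summand k m * recip (n ℕ.^ l)
summand-∷ʳ k m l n = trans (cong recip (product-∷ʳ k m)) (recip-* (foldr′ ℕ._*_ 1 (zipWith ℕ._^_ m k)) (n ℕ.^ l))
  where
  product-∷ʳ : ∀ {r} (k m : Vec ℕ r) → foldr′ ℕ._*_ 1 (zipWith ℕ._^_ (m ∷ʳ n) (k ∷ʳ l)) ≡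
               foldr′ ℕ._*_ 1 (zipWith ℕ._^_ m k) ℕ.* n ℕ.^ l
  product-∷ʳ []      []      = trans (ℕ.*-identityʳ (n ℕ.^ l)) (sym (ℕ.*-identityˡ (n ℕ.^ l)))
  product-∷ʳ (x ∷ k) (y ∷ m) = trans (cong (y ℕ.^ x ℕ.*_) (product-∷ʳ k m))
                                     (sym (ℕ.*-assoc (y ℕ.^ x) _ (n ℕ.^ l)))

sumℚ-++ : ∀ xs ys → sumℚ (xs ++ ys) ≡ sumℚ xs + sumℚ ys
sumℚ-++ []       ys = sym (+-identityˡ (sumℚ ys))
sumℚ-++ (x ∷ xs) ys = trans (cong (x ℚ.+_) (sumℚ-++ xs ys)) (sym (+-assoc x (sumℚ xs) (sumℚ ys)))

module _ {A : Set} {f : A → ℚ} (f≥0 : ∀ x → 0ℚ ≤ f x) where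

  sumℚ-nonNeg : ∀ xs → 0ℚ ≤ sumℚ (List.map f xs)
  sumℚ-nonNeg []       = ≤-refl
  sumℚ-nonNeg (x ∷ xs) = ≤-trans (sumℚ-nonNeg xs) (≤-+-nonNegˡ _ (f≥0 x))

  sumℚ-filter-≤ : ∀ {p} {P : Pred A p} (P? : Decidable P) xs →
                  sumℚ (List.map f (List.filter P? xs)) ≤ sumℚ (List.map f xs)
  sumℚ-filter-≤ P? []       = ≤-refl
  sumℚ-filter-≤ P? (x ∷ xs) with does (P? x)
  ... | true  = +-monoʳ-≤ (f x) (sumℚ-filter-≤ P? xs)
  ... | false = ≤-trans (sumℚ-filter-≤ P? xs) (≤-+-nonNegˡ _ (f≥0 x))

sumℚ-∷ʳ-≤ : ∀ {r} (k : Vec ℕ r) l n {w} → recip (n ℕ.^ l) ≤ w → ∀ ms →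
            sumℚ (List.map (summand (k ∷ʳ l)) (List.map (_∷ʳ n) ms)) ≤ sumℚ (List.map (summand k) ms) * w
sumℚ-∷ʳ-≤ k l n {w} _   []       = ≤-reflexive (sym (*-zeroˡ w))
sumℚ-∷ʳ-≤ k l n {w} n≤w (m ∷ ms) = subst (_ ≤_) (sym (*-distribʳ-+ w (summand k m) _))
  (+-mono-≤ (subst (_≤ summand k m * w) (sym (summand-∷ʳ k m l n))
              (*-monoˡ-≤-nonNeg (summand k m) {{ℚ.nonNegative (summand-nonNeg k m)}} n≤w))
            (sumℚ-∷ʳ-≤ k l n n≤w ms))

All-∷ʳ⁻ : ∀ {r} {P : Pred ℕ 0ℓ} (k : Vec ℕ r) {l} → All P (k ∷ʳ l) → All P k × P l
All-∷ʳ⁻ []      (p ∷ [])  = [] , p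
All-∷ʳ⁻ (x ∷ k) (p ∷ ps) with All-∷ʳ⁻ k ps
... | qs , q = p ∷ qs , q

recip-^-≤ : ∀ n {i j} → i ℕ.≤ j → recip (suc n ℕ.^ j) ≤ recip (suc n ℕ.^ i)
recip-^-≤ n {i} i≤j = recip-antimono (ℕ.m^n>0 (suc n) i) (ℕ.^-monoʳ-≤ (suc n) i≤j)

-- The truncated sum of 1/(m₁⋯mᵣ) over 0 < m₁ ≤ ⋯ ≤ mᵣ ≤ N.
harmonic : ℕ → ℕ → ℚ
harmonic zero    N       = 1ℚ
harmonic (suc r) zero    = 0ℚ
harmonic (suc r) (suc N) = harmonic (suc r) N + harmonic r (suc N) * recip (suc N)

harmonic-nonNeg : ∀ r N → 0ℚ ≤ harmonic r N
harmonic-nonNeg zero    N       = <⇒≤ 0<1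
harmonic-nonNeg (suc r) zero    = ≤-refl
harmonic-nonNeg (suc r) (suc N) = ≤-trans (harmonic-nonNeg (suc r) N)
  (≤-+-nonNegʳ _ (*-nonNeg (harmonic-nonNeg r (suc N)) (recip-nonNeg (suc N))))

sum-≤-harmonic : ∀ {r} {k : Vec ℕ r} → All (1 ℕ.≤_) k → ∀ N →
                 sumℚ (List.map (summand k) (weaklyIncreasing N r)) ≤ harmonic r N
sum-≤-harmonic {zero}  {[]} _   N       = ≤-refl
sum-≤-harmonic {suc r}      _   zero    = ≤-refl
sum-≤-harmonic {suc r} {k}  k≥1 (suc N) with initLast k
... | k′ , l , refl with All-∷ʳ⁻ k′ k≥1
... | k′≥1 , l≥1 = begin
  sumℚ (List.map (summand k) (old ++ new))                               ≡⟨ cong sumℚ (List.map-++ (summand k) old new) ⟩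
  sumℚ (List.map (summand k) old ++ List.map (summand k) new)            ≡⟨ sumℚ-++ (List.map (summand k) old) _ ⟩
  sumℚ (List.map (summand k) old) + sumℚ (List.map (summand k) new)      ≤⟨ +-mono-≤ (sum-≤-harmonic k≥1 N)
    (≤-trans (sumℚ-∷ʳ-≤ k′ l (suc N) l-bound (weaklyIncreasing (suc N) r))
             (*-monoʳ-≤-nonNeg u {{ℚ.nonNegative (recip-nonNeg (suc N))}} (sum-≤-harmonic k′≥1 (suc N)))) ⟩
  harmonic (suc r) N + harmonic r (suc N) * u                            ∎
  where
  open ≤-Reasoning
  u = recip (suc N)
  old = weaklyIncreasing N (suc r)
  new = List.map (_∷ʳ suc N) (weaklyIncreasing (suc N) r)
  l-bound : recip (suc N ℕ.^ l) ≤ u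
  l-bound = subst (λ d → recip (suc N ℕ.^ l) ≤ recip d) (ℕ.^-identityʳ (suc N)) (recip-^-≤ N l≥1)

fromℕ : ℕ → ℚ
fromℕ zero    = 0ℚ
fromℕ (suc n) = 1ℚ + fromℕ n

fromℕ-*-recip : ∀ n → fromℕ (suc n) * recip (suc n) ≡ 1ℚ
fromℕ-*-recip zero    = refl
fromℕ-*-recip (suc n) = begin-equality
  (1ℚ + f) * v               ≡⟨ expand f u v ⟩
  v + f * ((v + u * v) - u * v)  ≡⟨ cong (λ w → v + f * (w - u * v)) (recip-telescope n) ⟨
  v + f * (u - u * v)        ≡⟨ collect f u v ⟩
  v + (f * u) * (1ℚ - v)     ≡⟨ cong (λ w → v + w * (1ℚ - v)) (fromℕ-*-recip n) ⟩
  v + 1ℚ * (1ℚ - v)          ≡⟨ cancel v ⟩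
  1ℚ                         ∎
  where
  open ≤-Reasoning
  f = fromℕ (suc n)
  u = recip (suc n)
  v = recip (suc (suc n))
  expand : ∀ f u v → (1ℚ + f) * v ≡ v + f * ((v + u * v) - u * v)
  expand = solve 3 (λ f u v → (con 1ℚ :+ f) :* v := v :+ f :* ((v :+ u :* v) :- u :* v)) refl
  collect : ∀ f u v → v + f * (u - u * v) ≡ v + (f * u) * (1ℚ - v)
  collect = solve 3 (λ f u v → v :+ f :* (u :- u :* v) := v :+ (f :* u) :* (con 1ℚ :- v)) refl
  cancel : ∀ v → v + 1ℚ * (1ℚ - v) ≡ 1ℚ
  cancel = solve 1 (λ v → v :+ con 1ℚ :* (con 1ℚ :- v) := con 1ℚ) refl

-- Convergence to 0, for nonnegative sequences.
Vanishes : (ℕ → ℚ) → Set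
Vanishes x = ∀ ε → 0ℚ < ε → ∃ λ K → ∀ n → K ℕ.≤ n → x n < ε

Vanishes-+ : ∀ {x y} → Vanishes x → Vanishes y → Vanishes (λ n → x n + y n)
Vanishes-+ {x} {y} x→0 y→0 ε ε>0 with x→0 (½ * ε) (half-pos ε>0) | y→0 (½ * ε) (half-pos ε>0)
... | M , xM | N , yN = M ℕ.⊔ N , λ n M⊔N≤n → subst (x n + y n <_) (half+half ε)
  (+-mono-< (xM n (ℕ.m⊔n≤o⇒m≤o M N M⊔N≤n)) (yN n (ℕ.m⊔n≤o⇒n≤o M N M⊔N≤n)))

harmonic-sublinear : ∀ r → Vanishes (λ n → harmonic r n * recip n)
harmonic-sublinear zero    ε ε>0 = archimedean 1ℚ ε>0
harmonic-sublinear (suc r) ε ε>0 with harmonic-sublinear r (½ * ε) (half-pos ε>0)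
... | K , xK with archimedean (harmonic (suc r) K) (half-pos ε>0)
... | L , small = suc (K ℕ.⊔ L) , bound
  where
  open ≤-Reasoning
  H = harmonic (suc r)
  δ = ½ * ε

  growth : ∀ j → H (j ℕ.+ K) ≤ H K + fromℕ (j ℕ.+ K) * δ
  growth zero    = ≤-+-nonNegʳ (H K) (*-nonNeg (fromℕ-nonNeg K) (<⇒≤ (half-pos ε>0)))
    where
    fromℕ-nonNeg : ∀ n → 0ℚ ≤ fromℕ n
    fromℕ-nonNeg zero    = ≤-refl
    fromℕ-nonNeg (suc n) = ≤-trans (fromℕ-nonNeg n) (≤-+-nonNegˡ _ (<⇒≤ 0<1))
  growth (suc j) = ≤-trans
    (+-mono-≤ (growth j) (<⇒≤ (xK (suc (j ℕ.+ K)) (ℕ.m≤n+m K (suc j)))))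
    (≤-reflexive (regroup (H K) (fromℕ (j ℕ.+ K)) δ))
    where
    regroup : ∀ h f δ → (h + f * δ) + δ ≡ h + (1ℚ + f) * δ
    regroup = solve 3 (λ h f δ → (h :+ f :* δ) :+ δ := h :+ (con 1ℚ :+ f) :* δ) refl

  bound : ∀ n → suc (K ℕ.⊔ L) ℕ.≤ n → H n * recip n < ε
  bound n@(suc n-1) p = begin-strict
    H n * recip n                               ≤⟨ *-monoʳ-≤-nonNeg (recip n) {{ℚ.nonNegative (recip-nonNeg n)}}
                                                     (subst (λ i → H i ≤ H K + fromℕ i * δ)
                                                       (ℕ.m∸n+n≡m (ℕ.m⊔n≤o⇒m≤o K L K⊔L≤n)) (growth (n ℕ.∸ K))) ⟩
    (H K + fromℕ n * δ) * recip n               ≡⟨ regroup (H K) (fromℕ n) δ (recip n) ⟩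
    H K * recip n + (fromℕ n * recip n) * δ     ≡⟨ cong (λ w → H K * recip n + w * δ) (fromℕ-*-recip n-1) ⟩
    H K * recip n + 1ℚ * δ                      <⟨ +-monoˡ-< (1ℚ * δ) (small n (ℕ.m⊔n≤o⇒n≤o K L K⊔L≤n)) ⟩
    δ + 1ℚ * δ                                  ≡⟨ cong (δ ℚ.+_) (*-identityˡ δ) ⟩
    δ + δ                                       ≡⟨ half+half ε ⟩
    ε                                           ∎
    where
    K⊔L≤n = ℕ.≤-trans (ℕ.n≤1+n _) p
    regroup : ∀ h f δ u → (h + f * δ) * u ≡ h * u + (f * u) * δ
    regroup = solve 4 (λ h f δ u → (h :+ f :* δ) :* u := h :* u :+ (f :* u) :* δ) refl

-- tail-bound r N equals the sum over n > N of harmonic r n / ((n - 1) n);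
-- only the telescoping recurrence is needed.
tail-bound : ℕ → ℕ → ℚ
tail-bound zero    n = harmonic zero n * recip n
tail-bound (suc r) n = harmonic (suc r) n * recip n + tail-bound r n

tail-bound-vanishes : ∀ r → Vanishes (tail-bound r)
tail-bound-vanishes zero    = harmonic-sublinear zero
tail-bound-vanishes (suc r) = Vanishes-+ (harmonic-sublinear (suc r)) (tail-bound-vanishes r)

tail-bound-nonNeg : ∀ r n → 0ℚ ≤ tail-bound r n
tail-bound-nonNeg zero    n = *-nonNeg (harmonic-nonNeg zero n) (recip-nonNeg n)
tail-bound-nonNeg (suc r) n = ≤-trans (tail-bound-nonNeg r n)
  (≤-+-nonNegˡ _ (*-nonNeg (harmonic-nonNeg (suc r) n) (recip-nonNeg n)))

tail-bound-telescope : ∀ r n → tail-bound r (suc n) ≡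
  tail-bound r (suc (suc n)) + harmonic r (suc (suc n)) * (recip (suc n) * recip (suc (suc n)))
tail-bound-telescope zero    n = begin-equality
  1ℚ * u                     ≡⟨ cong (1ℚ *_) (recip-telescope n) ⟩
  1ℚ * (v + u * v)           ≡⟨ *-distribˡ-+ 1ℚ v (u * v) ⟩
  1ℚ * v + 1ℚ * (u * v)      ∎
  where
  open ≤-Reasoning
  u = recip (suc n)
  v = recip (suc (suc n))
tail-bound-telescope (suc r) n = begin-equality
  h * u + tail-bound r (suc n)                        ≡⟨ cong₂ (λ x y → h * x + y) (recip-telescope n) (tail-bound-telescope r n) ⟩
  h * (v + u * v) + (b + g * (u * v))                 ≡⟨ expand h u v b g ⟩
  (h * v + b) + (h * (u * v) + (g * v) * u)           ≡⟨ cong (λ x → (h * v + b) + (h * (u * v) + (g * v) * x)) (recip-telescope n) ⟩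
  (h * v + b) + (h * (u * v) + (g * v) * (v + u * v)) ≡⟨ collect h u v b g ⟩
  ((h + g * v) * v + b) + (h + g * v) * (u * v)       ∎
  where
  open ≤-Reasoning
  u = recip (suc n)
  v = recip (suc (suc n))
  h = harmonic (suc r) (suc n)
  g = harmonic r (suc (suc n))
  b = tail-bound r (suc (suc n))
  expand : ∀ h u v b g → h * (v + u * v) + (b + g * (u * v)) ≡ (h * v + b) + (h * (u * v) + (g * v) * u)
  expand = solve 5 (λ h u v b g → h :* (v :+ u :* v) :+ (b :+ g :* (u :* v)) :=
                                  (h :* v :+ b) :+ (h :* (u :* v) :+ (g :* v) :* u)) refl
  collect : ∀ h u v b g → (h * v + b) + (h * (u * v) + (g * v) * (v + u * v)) ≡
                          ((h + g * v) * v + b) + (h + g * v) * (u * v)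
  collect = solve 5 (λ h u v b g → (h :* v :+ b) :+ (h :* (u :* v) :+ (g :* v) :* (v :+ u :* v)) :=
                                   ((h :+ g :* v) :* v :+ b) :+ (h :+ g :* v) :* (u :* v)) refl

module _ {r} (c d : ℕ → ℚ)
         (step : ∀ n → c (suc n) ≡ c n + d n)
         (d≥0  : ∀ n → 0ℚ ≤ d n)
         (d≤   : ∀ n → d n ≤ harmonic r (suc n) * (recip (suc n) * recip (suc n))) where

  partial-increasing : ∀ N j → c N ≤ c (j ℕ.+ N)
  partial-increasing N zero    = ≤-refl
  partial-increasing N (suc j) = ≤-trans (partial-increasing N j)
    (subst (c (j ℕ.+ N) ≤_) (sym (step (j ℕ.+ N))) (≤-+-nonNegʳ _ (d≥0 (j ℕ.+ N))))

  corrected-decreasing : ∀ N j → c (j ℕ.+ suc N) + tail-bound r (j ℕ.+ suc N) ≤ c (suc N) + tail-bound r (suc N)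
  corrected-decreasing N zero    = ≤-refl
  corrected-decreasing N (suc j) = ≤-trans (subst (λ n → c (suc n) + B (suc n) ≤ c n + B n) (sym (ℕ.+-suc j N)) one-step) (corrected-decreasing N j)
    where
    open ≤-Reasoning
    B = tail-bound r
    n = j ℕ.+ N
    u = recip (suc n)
    v = recip (suc (suc n))
    one-step : c (suc (suc n)) + B (suc (suc n)) ≤ c (suc n) + B (suc n)
    one-step = begin
      c (suc (suc n)) + B (suc (suc n))                                   ≡⟨ cong (_+ B (suc (suc n))) (step (suc n)) ⟩
      (c (suc n) + d (suc n)) + B (suc (suc n))                           ≤⟨ +-monoˡ-≤ (B (suc (suc n))) (+-monoʳ-≤ (c (suc n)) (≤-trans (d≤ (suc n))
        (*-monoˡ-≤-nonNeg (harmonic r (suc (suc n))) {{ℚ.nonNegative (harmonic-nonNeg r (suc (suc n)))}}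
          (*-monoʳ-≤-nonNeg v {{ℚ.nonNegative (recip-nonNeg (suc (suc n)))}} (recip-antimono (s≤s z≤n) (ℕ.n≤1+n (suc n))))))) ⟩
      (c (suc n) + harmonic r (suc (suc n)) * (u * v)) + B (suc (suc n))  ≡⟨ regroup (c (suc n)) _ (B (suc (suc n))) ⟩
      c (suc n) + (B (suc (suc n)) + harmonic r (suc (suc n)) * (u * v))  ≡⟨ cong (c (suc n) ℚ.+_) (tail-bound-telescope r n) ⟨
      c (suc n) + B (suc n)                                               ∎
      where
      regroup : ∀ a x b → (a + x) + b ≡ a + (b + x)
      regroup = solve 3 (λ a x b → (a :+ x) :+ b := a :+ (b :+ x)) refl

  squeezed : ∀ {b ε x y} → b ≤ x → x < b + ε → b ≤ y → y < b + ε → ∣ x - y ∣ < ε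
  squeezed {b} {ε} {x} {y} b≤x x<b+ε b≤y y<b+ε = by-sign (∣p∣≡p∨∣p∣≡-p (x - y))
    where
    drop : ∀ b ε → (b + ε) - b ≡ ε
    drop = solve 2 (λ b ε → (b :+ ε) :- b := ε) refl
    flip : ∀ x y → y - x ≡ - (x - y)
    flip = solve 2 (λ x y → y :- x := :- (x :- y)) refl
    difference : ∀ {x y} → x < b + ε → b ≤ y → x - y < ε
    difference {x} {y} x<b+ε b≤y = subst (x - y <_) (drop b ε) (+-mono-<-≤ x<b+ε (neg-antimono-≤ b≤y))
    by-sign : ∣ x - y ∣ ≡ x - y ⊎ ∣ x - y ∣ ≡ - (x - y) → ∣ x - y ∣ < ε
    by-sign (inj₁ eq) = subst (_< ε) (sym eq) (difference x<b+ε b≤y)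
    by-sign (inj₂ eq) = subst (_< ε) (sym (trans eq (sym (flip x y)))) (difference y<b+ε b≤x)

  telescoping-cauchy : IsCauchy c
  telescoping-cauchy ε ε>0 with tail-bound-vanishes r ε ε>0
  ... | K , small = suc K , λ m n K<m K<n → squeezed (below K<m) (above K<m) (below K<n) (above K<n)
    where
    below : ∀ {n} → K ℕ.< n → c (suc K) ≤ c n
    below {n} K<n = subst (λ i → c (suc K) ≤ c i) (ℕ.m∸n+n≡m K<n) (partial-increasing (suc K) (n ℕ.∸ suc K))
    above : ∀ {n} → K ℕ.< n → c n < c (suc K) + ε
    above {n} K<n = ≤-<-trans
      (≤-trans (≤-+-nonNegʳ (c n) (tail-bound-nonNeg r n))
        (subst (λ i → c i + tail-bound r i ≤ c (suc K) + tail-bound r (suc K)) (ℕ.m∸n+n≡m K<n) (corrected-decreasing K (n ℕ.∸ suc K))))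
      (+-monoʳ-< (c (suc K)) (small (suc K) (ℕ.n≤1+n K)))

ζ-partial-cauchy : ∀ {r} (k : Vec ℕ (suc r)) → Admissible k → ∀ j → IsCauchy (ζ-partial k j)
ζ-partial-cauchy {r} k (k≥1 , l≥2) j = telescoping-cauchy {r} (ζ-partial k j) d step d≥0 d≤
  where
  P? : Decidable (λ (m : Vec ℕ (suc r)) → equalities m ≡ j)
  P? m = equalities m ℕ.≟ j

  new : ℕ → List (Vec ℕ (suc r))
  new n = List.map (_∷ʳ suc n) (weaklyIncreasing (suc n) r)

  d : ℕ → ℚ
  d n = sumℚ (List.map (summand k) (List.filter P? (new n)))

  step : ∀ n → ζ-partial k j (suc n) ≡ ζ-partial k j n + d n
  step n = trans
    (cong sumℚ (trans (cong (List.map (summand k)) (List.filter-++ P? old (new n)))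
                      (List.map-++ (summand k) (List.filter P? old) (List.filter P? (new n)))))
    (sumℚ-++ (List.map (summand k) (List.filter P? old)) (List.map (summand k) (List.filter P? (new n))))
    where
    old = weaklyIncreasing n (suc r)

  d≥0 : ∀ n → 0ℚ ≤ d n
  d≥0 n = sumℚ-nonNeg (summand-nonNeg k) (List.filter P? (new n))

  new-≤ : ∀ k′ l → All (1 ℕ.≤_) k′ → 2 ℕ.≤ l → ∀ n →
          sumℚ (List.map (summand (k′ ∷ʳ l)) (new n)) ≤ harmonic r (suc n) * (recip (suc n) * recip (suc n))
  new-≤ k′ l k′≥1 l≥2 n = ≤-trans
    (sumℚ-∷ʳ-≤ k′ l (suc n) l-bound (weaklyIncreasing (suc n) r))
    (*-monoʳ-≤-nonNeg (u * u) {{ℚ.nonNegative (*-nonNeg (recip-nonNeg (suc n)) (recip-nonNeg (suc n)))}}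
      {y = harmonic r (suc n)} (sum-≤-harmonic k′≥1 (suc n)))
    where
    u = recip (suc n)
    l-bound : recip (suc n ℕ.^ l) ≤ u * u
    l-bound = subst (recip (suc n ℕ.^ l) ≤_)
      (trans (recip-* (suc n) (suc n ℕ.^ 1)) (cong (λ i → u * recip i) (ℕ.^-identityʳ (suc n))))
      (recip-^-≤ n l≥2)

  d≤ : ∀ n → d n ≤ harmonic r (suc n) * (recip (suc n) * recip (suc n))
  d≤ n = ≤-trans (sumℚ-filter-≤ (summand-nonNeg k) P? (new n))
    (subst (λ k → sumℚ (List.map (summand k) (new n)) ≤ harmonic r (suc n) * (recip (suc n) * recip (suc n)))
      (sym (proj₂ (proj₂ (initLast k)))) (new-≤ (init k) (last k) k≥1 l≥2 n))

-- Polynomials in one variable, as lists of coefficients in increasing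
-- degree; trailing zeros are allowed and equality is coefficientwise.
module Polynomial {c ℓ : Level} (R : RawRing c ℓ) where

  private module R = RawRing R

  Poly : Set c
  Poly = List R.Carrier

  coeff : Poly → ℕ → R.Carrier
  coeff []      n       = R.0#
  coeff (a ∷ p) zero    = a
  coeff (a ∷ p) (suc n) = coeff p n

  add : Poly → Poly → Poly
  add []      q       = q
  add (a ∷ p) []      = a ∷ p
  add (a ∷ p) (b ∷ q) = (a R.+ b) ∷ add p q

  mul : Poly → Poly → Poly
  mul []      q = []
  mul (a ∷ p) q = add (List.map (a R.*_) q) (R.0# ∷ mul p q)

  rawRing : RawRing c ℓ
  rawRing = record
    { Carrier = Poly
    ; _≈_     = λ p q → ∀ n → coeff p n R.≈ coeff q n
    ; _+_     = add
    ; _*_     = mul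
    ; -_      = List.map R.-_
    ; 0#      = []
    ; 1#      = R.1# ∷ []
    }

  -- p(q(t))
  compose : Poly → Poly → Poly
  compose p q = List.foldr (λ a acc → add (a ∷ []) (mul q acc)) [] p

-- Laplace expansion along the first row.
module Determinant {c ℓ : Level} (R : RawRing c ℓ) where

  private module R = RawRing R
  open RawMonoidDefinitions R.+-rawMonoid using (sum)
  open RawSemiringDefinitions R.rawSemiring using (_^_)

  det : ∀ {n} → (Fin n → Fin n → R.Carrier) → R.Carrier
  det {zero}  M = R.1#
  det {suc n} M = sum λ j →
    ((R.- R.1#) ^ toℕ j) R.* (M Fin.zero j R.* det (λ i k → M (Fin.suc i) (punchIn j k)))

open Polynomial ℝ-rawRing using (compose)

ℝ[t] : RawRing 0ℓ 0ℓ
ℝ[t] = Polynomial.rawRing ℝ-rawRing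

open RawRing ℝ[t] public using () renaming (Carrier to ℝ[t]-Carrier; _≈_ to _≈ℝ[t]_)
open Determinant ℝ[t] public using (det)

-- The number of equalities among m₁ ≤ ⋯ ≤ mᵣ₊₁ is at most r, so the degree
-- is at most r.
ζᵗ : ∀ {r} (k : Vec ℕ (suc r)) → Admissible k → ℝ[t]-Carrier
ζᵗ {r} k k-adm = List.tabulate λ (j : Fin (suc r)) →
  mkℝ (ζ-partial k (toℕ j)) (ζ-partial-cauchy k k-adm (toℕ j))

ζ¹⁻ᵗ : ∀ {r} (k : Vec ℕ (suc r)) → Admissible k → ℝ[t]-Carrier
ζ¹⁻ᵗ k k-adm = compose (ζᵗ k k-adm) (fromℚ 1ℚ ∷ fromℚ (- 1ℚ) ∷ [])

record Partition : Set where
  field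
    height     : ℕ
    parts      : Vec ℕ height
    decreasing : Linked ℕ._≥_ parts
    positive   : All (1 ℕ.≤_) parts

  -- λ₁, read as 0 for the empty partition.
  width : ℕ
  width = first parts
    where
    first : ∀ {h} → Vec ℕ h → ℕ
    first []      = 0
    first (p ∷ _) = p

  conjugate : Vec ℕ width
  conjugate = Vec.tabulate λ j → count (suc (toℕ j) ℕ.≤?_) parts

-- Matrix rows and columns are numbered from 1.
index : ∀ {n} → Fin n → ℤ
index i = + suc (toℕ i)

module _ (b : ℤ → ℕ) (b≥2 : ∀ p → 2 ℕ.≤ b p) where

  -- (b 1, …, b n)
  arguments : ∀ n → Vec ℕ n
  arguments n = Vec.tabulate λ p → b (index p)

  arguments-admissible : ∀ r → Admissible (arguments (suc r))
  arguments-admissible r = All.map ℕ.<⇒≤ (proj₁ init-last≥2) , proj₂ init-last≥2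
    where
    k = arguments (suc r)
    init-last≥2 : All (2 ℕ.≤_) (init k) × 2 ℕ.≤ last k
    init-last≥2 = All-∷ʳ⁻ (init k)
      (subst (All (2 ℕ.≤_)) (proj₂ (proj₂ (initLast k))) (All.tabulate⁺ {f = b ∘ index} (b≥2 ∘ index)))

  -- Z(b 1, …, b n), set to 1 if n = 0 and to 0 if n < 0.
  entry : (∀ {r} (k : Vec ℕ (suc r)) → Admissible k → ℝ[t]-Carrier) → ℤ → ℝ[t]-Carrier
  entry Z (+ zero)  = RawRing.1# ℝ[t]
  entry Z (+ suc r) = Z (arguments (suc r)) (arguments-admissible r)
  entry Z -[1+ _ ]  = RawRing.0# ℝ[t]

{-# OPTIONS --safe #-}
module Submission where

-- All operations on ℝ[t] act termwise on representatives, so it suffices to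
-- prove the identity in ℚ[t] for every truncation mᵣ ≤ N. Number the positions
-- along the boundary of the Young diagram. The truncated ζ¹⁻ᵗ of the
-- increasing runs of arguments and the truncated ζᵗ of the decreasing runs,
-- with signs, are the entries of two mutually inverse unitriangular matrices:
-- a single value m contributes the factor (1 + (1 - t)X)/(1 - tX), where X is
-- a weighted shift, and its inverse arises by X ↦ -X and t ↦ 1 - t. The two
-- determinants are complementary minors of these matrices, because the
-- positions λᵢ - i and j - 1 - λ′ⱼ partition an interval, and Jacobi's
-- identity applies. It is proved in the exterior algebra.

open import Defs using (Partition; det; entry; index; ζᵗ; ζ¹⁻ᵗ; _≈ℝ[t]_)
open import Defs using (module Determinant; module Polynomial; recip; ℝ; mkℝ; seq; fromℚ; ℝ-rawRing;
  ℝ[t]; ℝ[t]-Carrier; weaklyIncreasing; equalities; summand; summand-∷ʳ; sumℚ; ζ-partial;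
  ζ-partial-cauchy; Admissible; arguments; arguments-admissible)

open import Algebra.Bundles using (CommutativeRing; RawRing)
import Algebra.Definitions.RawMonoid as RawMonoidDefinitions
import Algebra.Definitions.RawSemiring as RawSemiringDefinitions
import Algebra.Properties.CommutativeMonoid.Sum as CommutativeMonoidSum
import Algebra.Properties.Ring as RingProperties
import Algebra.Properties.Semiring.Exp as SemiringExponentiation
import Algebra.Properties.Semiring.Mult.TCOptimised as SemiringMultiplication
import Algebra.Properties.Semiring.Sum as SemiringSum
import Algebra.Solver.Ring as RingSolver
open import Algebra.Solver.Ring.AlmostCommutativeRing using (fromCommutativeRing; _-Raw-AlmostCommutative⟶_)
open import Data.Bool.Base using (Bool; true; false; not; if_then_else_)
open import Data.Bool.Properties using (not-involutive)
open import Data.Fin.Base using (Fin; zero; suc; toℕ; fromℕ; inject₁; punchIn)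
import Data.Fin.Properties as Fin
open import Data.Integer.Base using (ℤ; +_; -[1+_])
import Data.Integer.Base as ℤ
import Data.Integer.Properties as ℤ
import Data.Integer.Solver as ℤ
open import Data.List.Base as List using (List; []; _∷_; _++_)
import Data.List.Properties as List
import Data.List.Relation.Unary.All as ListAll
import Data.List.Relation.Unary.All.Properties as ListAll
import Data.Maybe.Base as Maybe
open import Data.Nat.Base using (ℕ; zero; suc; _≤_; _<_; s≤s)
import Data.Nat.Base as ℕ
import Data.Nat.Properties as ℕ
open import Data.Product.Base using (∃₂; _×_; _,_)
open import Data.Rational.Base using (ℚ; 0ℚ; 1ℚ)
import Data.Rational.Base as ℚ
import Data.Rational.Properties as ℚ
open import Data.Sum.Base using (_⊎_; inj₁; inj₂)
open import Data.Vec.Base as Vec using (Vec; []; _∷_; _∷ʳ_; count; lookup; map; reverse)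
import Data.Vec.Properties as Vec
open import Data.Vec.Relation.Unary.Linked using (Linked; []; [-]; _∷_)
open import Function.Base using (_∘_; _⟨_⟩_; id)
open import Level using (Level; _⊔_)
open import Relation.Binary.Consequences using (dec⇒weaklyDec)
open import Relation.Binary.PropositionalEquality as ≡ using (_≡_; module ≡-Reasoning)
import Relation.Binary.Reasoning.Setoid as SetoidReasoning
open import Relation.Nullary.Decidable using (Dec; yes; no; does; dec-true; dec-false)
open import Relation.Nullary.Negation using (¬_; contradiction)

-- A value m that occurs d ≥ 1 times contributes t^(d-1) X^d, and 1 + Σ t^(d-1) X^d = (1 + (1 -
-- t)X)/(1 - tX); this is the origin of the exchange of t and 1 - t. The weights of X depend on the
-- position, so the shifts for different m do not commute. Inverting their product reverses its
-- order, which is why the arguments ascend on one side of the identity and descend on the other. No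
-- operator is inverted explicitly: raising the truncation bound by one changes the pairing of the
-- two matrices by an alternating sum that telescopes. The obstacle is the bookkeeping of signs. X ↦
-- -X puts signs on the entries of the inverse and complementary minors bring signs of their own,
-- while the entries of the theorem have none. The signs of X ↦ -X are therefore built into the
-- contraction of forms, and those of the minors are absorbed by reversing the order of the
-- coordinates.

-- Integers as solver coefficients in an arbitrary commutative ring.

module IntegerCoefficients {c ℓ : Level} (R : CommutativeRing c ℓ) where
  open CommutativeRing R
  open RingProperties ring
  open SemiringMultiplication semiring renaming (_×_ to _·_)
  open SetoidReasoning setoid

  -- The optimised multiple makes `1 · 1#` reduce to `1#`, so that `con (+ 1)` in a solver equation
  -- matches `1#` definitionally.
  ⟦_⟧ℤ : ℤ → Carrier
  ⟦ + n ⟧ℤ      = n · 1#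
  ⟦ -[1+ n ] ⟧ℤ = - (suc n · 1#)

  ⟦⟧-neg : ∀ i → ⟦ ℤ.- i ⟧ℤ ≈ - ⟦ i ⟧ℤ
  ⟦⟧-neg (+ zero)   = sym -0#≈0#
  ⟦⟧-neg (+ suc n)  = refl
  ⟦⟧-neg (-[1+ n ]) = sym (-‿involutive _)

  ⟦⟧-⊖ : ∀ m n → ⟦ m ℤ.⊖ n ⟧ℤ ≈ m · 1# - n · 1#
  ⟦⟧-⊖ m       zero    = sym (trans (+-congˡ -0#≈0#) (+-identityʳ _))
  ⟦⟧-⊖ zero    (suc n) = sym (+-identityˡ _)
  ⟦⟧-⊖ (suc m) (suc n) = begin
    ⟦ suc m ℤ.⊖ suc n ⟧ℤ                 ≡⟨ ≡.cong ⟦_⟧ℤ (ℤ.[1+m]⊖[1+n]≡m⊖n m n) ⟩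
    ⟦ m ℤ.⊖ n ⟧ℤ                         ≈⟨ ⟦⟧-⊖ m n ⟩
    m · 1# - n · 1#                      ≈⟨ +-identityˡ _ ⟨
    0# + (m · 1# - n · 1#)               ≈⟨ +-congʳ (-‿inverseʳ 1#) ⟨
    (1# - 1#) + (m · 1# - n · 1#)        ≈⟨ +-assoc 1# (- 1#) _ ⟩
    1# + (- 1# + (m · 1# - n · 1#))      ≈⟨ +-congˡ (+-assoc (- 1#) (m · 1#) _) ⟨
    1# + ((- 1# + m · 1#) - n · 1#)      ≈⟨ +-congˡ (+-congʳ (+-comm _ _)) ⟩
    1# + ((m · 1# - 1#) - n · 1#)        ≈⟨ +-congˡ (+-assoc _ _ _) ⟩
    1# + (m · 1# + (- 1# - n · 1#))      ≈⟨ +-assoc 1# (m · 1#) _ ⟨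
    (1# + m · 1#) + (- 1# - n · 1#)      ≈⟨ +-congˡ (-‿+-comm 1# (n · 1#)) ⟩
    (1# + m · 1#) - (1# + n · 1#)        ≈⟨ +-cong (1+× m 1#) (-‿cong (1+× n 1#)) ⟨
    suc m · 1# - suc n · 1#              ∎

  ⟦⟧-+ : ∀ i j → ⟦ i ℤ.+ j ⟧ℤ ≈ ⟦ i ⟧ℤ + ⟦ j ⟧ℤ
  ⟦⟧-+ (+ m)    (+ n)    = ×-homo-+ 1# m n
  ⟦⟧-+ (+ m)    -[1+ n ] = ⟦⟧-⊖ m (suc n)
  ⟦⟧-+ -[1+ m ] (+ n)    = trans (⟦⟧-⊖ n (suc m)) (+-comm _ _)
  ⟦⟧-+ -[1+ m ] -[1+ n ] = begin
    ⟦ -[1+ m ] ℤ.+ -[1+ n ] ⟧ℤ             ≡⟨ ≡.cong ⟦_⟧ℤ (ℤ.neg-distrib-+ (+ suc m) (+ suc n)) ⟨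
    ⟦ ℤ.- (+ (suc m ℕ.+ suc n)) ⟧ℤ         ≈⟨ ⟦⟧-neg (+ (suc m ℕ.+ suc n)) ⟩
    - ((suc m ℕ.+ suc n) · 1#)             ≈⟨ -‿cong (×-homo-+ 1# (suc m) (suc n)) ⟩
    - (suc m · 1# + suc n · 1#)            ≈⟨ -‿+-comm _ _ ⟨
    - (suc m · 1#) - suc n · 1#            ∎

  ⟦⟧-*-pos : ∀ m j → ⟦ + m ℤ.* j ⟧ℤ ≈ ⟦ + m ⟧ℤ * ⟦ j ⟧ℤ
  ⟦⟧-*-pos m (+ n)      = trans (reflexive (≡.cong ⟦_⟧ℤ (≡.sym (ℤ.pos-* m n)))) (×1-homo-* m n)
  ⟦⟧-*-pos m (-[1+ n ]) = begin
    ⟦ + m ℤ.* -[1+ n ] ⟧ℤ             ≡⟨ ≡.cong ⟦_⟧ℤ (ℤ.neg-distribʳ-* (+ m) (+ suc n)) ⟨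
    ⟦ ℤ.- (+ m ℤ.* + suc n) ⟧ℤ        ≈⟨ ⟦⟧-neg (+ m ℤ.* + suc n) ⟩
    - ⟦ + m ℤ.* + suc n ⟧ℤ            ≈⟨ -‿cong (⟦⟧-*-pos m (+ suc n)) ⟩
    - (m · 1# * (suc n · 1#))         ≈⟨ -‿distribʳ-* _ _ ⟩
    m · 1# * - (suc n · 1#)           ∎

  ⟦⟧-* : ∀ i j → ⟦ i ℤ.* j ⟧ℤ ≈ ⟦ i ⟧ℤ * ⟦ j ⟧ℤ
  ⟦⟧-* (+ m)    j = ⟦⟧-*-pos m j
  ⟦⟧-* -[1+ m ] j = begin
    ⟦ -[1+ m ] ℤ.* j ⟧ℤ          ≡⟨ ≡.cong ⟦_⟧ℤ (ℤ.neg-distribˡ-* (+ suc m) j) ⟨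
    ⟦ ℤ.- (+ suc m ℤ.* j) ⟧ℤ     ≈⟨ ⟦⟧-neg (+ suc m ℤ.* j) ⟩
    - ⟦ + suc m ℤ.* j ⟧ℤ         ≈⟨ -‿cong (⟦⟧-*-pos (suc m) j) ⟩
    - (suc m · 1# * ⟦ j ⟧ℤ)      ≈⟨ -‿distribˡ-* _ _ ⟩
    - (suc m · 1#) * ⟦ j ⟧ℤ      ∎

  morphism : ℤ.+-*-rawRing -Raw-AlmostCommutative⟶ fromCommutativeRing R
  morphism = record
    { ⟦_⟧    = ⟦_⟧ℤ
    ; +-homo = ⟦⟧-+
    ; *-homo = ⟦⟧-*
    ; -‿homo = ⟦⟧-neg
    ; 0-homo = refl
    ; 1-homo = refl
    }

  -- Cancellation of coefficients needs a test for equality. Integers have one, elements of an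
  -- arbitrary ring do not.
  module Solver = RingSolver ℤ.+-*-rawRing (fromCommutativeRing R) morphism
    (λ i j → Maybe.map (λ eq → reflexive (≡.cong ⟦_⟧ℤ eq)) (dec⇒weaklyDec ℤ._≟_ i j))

-- The Cauchy product of coefficient sequences.

module PowerSeriesProduct {c ℓ : Level} (R : CommutativeRing c ℓ) where
  open CommutativeRing R hiding (zero)
  open IntegerCoefficients R using (module Solver)
  open Solver using (solve; _:=_; _:+_; _:*_)
  open SetoidReasoning setoid

  conv : (ℕ → Carrier) → (ℕ → Carrier) → ℕ → Carrier
  conv f g zero    = f 0 * g 0
  conv f g (suc n) = f 0 * g (suc n) + conv (f ∘ suc) g n

  conv-cong : ∀ {f f′ g g′} → (∀ n → f n ≈ f′ n) → (∀ n → g n ≈ g′ n) → ∀ n → conv f g n ≈ conv f′ g′ n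
  conv-cong f≈ g≈ zero    = *-cong (f≈ 0) (g≈ 0)
  conv-cong f≈ g≈ (suc n) = +-cong (*-cong (f≈ 0) (g≈ (suc n))) (conv-cong (f≈ ∘ suc) g≈ n)

  conv-last : ∀ f g n → conv f g (suc n) ≈ conv f (g ∘ suc) n + f (suc n) * g 0
  conv-last f g zero    = refl
  conv-last f g (suc n) = trans (+-congˡ (conv-last (f ∘ suc) g n)) (sym (+-assoc _ _ _))

  conv-comm : ∀ f g n → conv f g n ≈ conv g f n
  conv-comm f g zero    = *-comm _ _
  conv-comm f g (suc n) = begin
    f 0 * g (suc n) + conv (f ∘ suc) g n   ≈⟨ +-cong (*-comm _ _) (conv-comm (f ∘ suc) g n) ⟩
    g (suc n) * f 0 + conv g (f ∘ suc) n   ≈⟨ +-comm _ _ ⟩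
    conv g (f ∘ suc) n + g (suc n) * f 0   ≈⟨ conv-last g f n ⟨
    conv g f (suc n)                       ∎

  -- The combination `a * f i + f′ i` is the shape of `conv f g ∘ suc`, so this is the inductive
  -- step of `conv-assoc`.
  conv-linear : ∀ a f f′ g n → conv (λ i → a * f i + f′ i) g n ≈ a * conv f g n + conv f′ g n
  conv-linear a f f′ g zero    =
    solve 4 (λ a x y z → (a :* x :+ y) :* z := a :* (x :* z) :+ y :* z) refl a (f 0) (f′ 0) (g 0)
  conv-linear a f f′ g (suc n) = trans (+-congˡ (conv-linear a (f ∘ suc) (f′ ∘ suc) g n))
    (solve 6 (λ a x y z p q → (a :* x :+ y) :* z :+ (a :* p :+ q) := a :* (x :* z :+ p) :+ (y :* z :+ q)) refl
      a (f 0) (f′ 0) (g (suc n)) _ _)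

  conv-assoc : ∀ f g h n → conv (conv f g) h n ≈ conv f (conv g h) n
  conv-assoc f g h zero    = *-assoc _ _ _
  conv-assoc f g h (suc n) = begin
    f 0 * g 0 * h (suc n) + conv (λ i → f 0 * g (suc i) + conv (f ∘ suc) g i) h n
      ≈⟨ +-congˡ (conv-linear (f 0) (g ∘ suc) (conv (f ∘ suc) g) h n) ⟩
    f 0 * g 0 * h (suc n) + (f 0 * conv (g ∘ suc) h n + conv (conv (f ∘ suc) g) h n)
      ≈⟨ +-congˡ (+-congˡ (conv-assoc (f ∘ suc) g h n)) ⟩
    f 0 * g 0 * h (suc n) + (f 0 * conv (g ∘ suc) h n + conv (f ∘ suc) (conv g h) n)
      ≈⟨ solve 5 (λ x y z p q → x :* y :* z :+ (x :* p :+ q) := x :* (y :* z :+ p) :+ q) refl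
           (f 0) (g 0) (h (suc n)) _ _ ⟩
    f 0 * (g 0 * h (suc n) + conv (g ∘ suc) h n) + conv (f ∘ suc) (conv g h) n ∎

  conv-zeroˡ : ∀ {f} g → (∀ n → f n ≈ 0#) → ∀ n → conv f g n ≈ 0#
  conv-zeroˡ g f≈0 zero    = trans (*-congʳ (f≈0 0)) (zeroˡ _)
  conv-zeroˡ g f≈0 (suc n) = trans
    (+-cong (trans (*-congʳ (f≈0 0)) (zeroˡ _)) (conv-zeroˡ g (f≈0 ∘ suc) n)) (+-identityˡ 0#)

-- The ring of polynomials and substitution into them.

module PolynomialRing {c ℓ : Level} (R : CommutativeRing c ℓ) where
  open CommutativeRing R hiding (zero; rawRing)
  open RingProperties ring using (-0#≈0#)
  open PowerSeriesProduct R
  open Polynomial (CommutativeRing.rawRing R) public hiding (rawRing)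
  open SetoidReasoning setoid

  coeff-add : ∀ p q n → coeff (add p q) n ≈ coeff p n + coeff q n
  coeff-add []      q       n       = sym (+-identityˡ _)
  coeff-add (a ∷ p) []      n       = sym (+-identityʳ _)
  coeff-add (a ∷ p) (b ∷ q) zero    = refl
  coeff-add (a ∷ p) (b ∷ q) (suc n) = coeff-add p q n

  coeff-map : ∀ (f : Carrier → Carrier) → f 0# ≈ 0# → ∀ p n → coeff (List.map f p) n ≈ f (coeff p n)
  coeff-map f f0≈0 []      n       = sym f0≈0
  coeff-map f f0≈0 (a ∷ p) zero    = refl
  coeff-map f f0≈0 (a ∷ p) (suc n) = coeff-map f f0≈0 p n

  -- The ring laws fail for the lists themselves, which may differ by trailing zeros. This lemma
  -- moves them to coefficient sequences, where they are laws of `conv`.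
  coeff-mul : ∀ p q n → coeff (mul p q) n ≈ conv (coeff p) (coeff q) n
  coeff-mul []      q n = sym (conv-zeroˡ (coeff q) (λ _ → refl) n)
  coeff-mul (a ∷ p) q n = begin
    coeff (add (List.map (a *_) q) (0# ∷ mul p q)) n        ≈⟨ coeff-add (List.map (a *_) q) _ n ⟩
    coeff (List.map (a *_) q) n + coeff (0# ∷ mul p q) n    ≈⟨ +-congʳ (coeff-map (a *_) (zeroʳ a) q n) ⟩
    a * coeff q n + coeff (0# ∷ mul p q) n                  ≈⟨ shifted n ⟩
    conv (coeff (a ∷ p)) (coeff q) n                        ∎
    where
    shifted : ∀ n → a * coeff q n + coeff (0# ∷ mul p q) n ≈ conv (coeff (a ∷ p)) (coeff q) n
    shifted zero    = +-identityʳ _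
    shifted (suc n) = +-congˡ (coeff-mul p q n)

  coeff-constant-* : ∀ a p n → coeff (mul (a ∷ []) p) n ≈ a * coeff p n
  coeff-constant-* a p zero    = coeff-mul (a ∷ []) p 0
  coeff-constant-* a p (suc n) = trans (coeff-mul (a ∷ []) p (suc n))
    (trans (+-congˡ (conv-zeroˡ (coeff p) (λ _ → refl) n)) (+-identityʳ _))

  coeff-neg : ∀ p n → coeff (List.map (-_) p) n ≈ - coeff p n
  coeff-neg = coeff-map (-_) -0#≈0#

  -- Unlike the coefficientwise equality itself, a record lets Agda infer both
  -- polynomials from an equation.
  infix 4 _≋_
  record _≋_ (p q : Poly) : Set ℓ where
    constructor coefficientwise
    field
      at : ∀ n → coeff p n ≈ coeff q n

  open _≋_ public

  commutativeRing : CommutativeRing c ℓ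
  commutativeRing = record
    { Carrier           = Poly
    ; _≈_               = _≋_
    ; _+_               = add
    ; _*_               = mul
    ; -_                = List.map (-_)
    ; 0#                = []
    ; 1#                = 1# ∷ []
    ; isCommutativeRing = record
      { isRing = record
        { +-isAbelianGroup = record
          { isGroup = record
            { isMonoid = record
              { isSemigroup = record
                { isMagma = record
                  { isEquivalence = record
                    { refl  = coefficientwise λ _ → refl
                    ; sym   = λ p≈q → coefficientwise λ n → sym (at p≈q n)
                    ; trans = λ p≈q q≈r → coefficientwise λ n → trans (at p≈q n) (at q≈r n)
                    }
                  ; ∙-cong = λ {p} {p′} {q} {q′} p≈p′ q≈q′ → coefficientwise λ n → by-coeff-add p q p′ q′ n (+-cong (at p≈p′ n) (at q≈q′ n))
                  }
                ; assoc = λ p q r → coefficientwise λ n → begin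
                    coeff (add (add p q) r) n              ≈⟨ coeff-add (add p q) r n ⟩
                    coeff (add p q) n + coeff r n          ≈⟨ +-congʳ (coeff-add p q n) ⟩
                    (coeff p n + coeff q n) + coeff r n    ≈⟨ +-assoc _ _ _ ⟩
                    coeff p n + (coeff q n + coeff r n)    ≈⟨ +-congˡ (coeff-add q r n) ⟨
                    coeff p n + coeff (add q r) n          ≈⟨ coeff-add p (add q r) n ⟨
                    coeff (add p (add q r)) n              ∎
                }
              ; identity = (λ p → coefficientwise λ n → refl) , (λ p → coefficientwise λ n → trans (coeff-add p [] n) (+-identityʳ _))
              }
            ; inverse = (λ p → coefficientwise λ n → trans (coeff-add (List.map (-_) p) p n) (trans (+-congʳ (coeff-neg p n)) (-‿inverseˡ _)))
                      , (λ p → coefficientwise λ n → trans (coeff-add p (List.map (-_) p) n) (trans (+-congˡ (coeff-neg p n)) (-‿inverseʳ _)))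
            ; ⁻¹-cong = λ {p} {q} p≈q → coefficientwise λ n → trans (coeff-neg p n) (trans (-‿cong (at p≈q n)) (sym (coeff-neg q n)))
            }
          ; comm = λ p q → coefficientwise λ n → by-coeff-add p q q p n (+-comm _ _)
          }
        ; *-cong = λ {p} {p′} {q} {q′} p≈p′ q≈q′ → coefficientwise λ n →
            trans (coeff-mul p q n) (trans (conv-cong (at p≈p′) (at q≈q′) n) (sym (coeff-mul p′ q′ n)))
        ; *-assoc = λ p q r → coefficientwise λ n → begin
            coeff (mul (mul p q) r) n                          ≈⟨ coeff-mul (mul p q) r n ⟩
            conv (coeff (mul p q)) (coeff r) n                 ≈⟨ conv-cong (coeff-mul p q) (λ _ → refl) n ⟩
            conv (conv (coeff p) (coeff q)) (coeff r) n        ≈⟨ conv-assoc (coeff p) (coeff q) (coeff r) n ⟩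
            conv (coeff p) (conv (coeff q) (coeff r)) n        ≈⟨ conv-cong (λ _ → refl) (coeff-mul q r) n ⟨
            conv (coeff p) (coeff (mul q r)) n                 ≈⟨ coeff-mul p (mul q r) n ⟨
            coeff (mul p (mul q r)) n                          ∎
        ; *-identity = (λ p → coefficientwise (mul-identityˡ p)) , (λ p → coefficientwise λ n → trans (mul-comm p (1# ∷ []) n) (mul-identityˡ p n))
        ; distrib = (λ p q r → coefficientwise λ n → begin
            coeff (mul p (add q r)) n                          ≈⟨ mul-comm p (add q r) n ⟩
            coeff (mul (add q r) p) n                          ≈⟨ mul-distribʳ p q r n ⟩
            coeff (add (mul q p) (mul r p)) n
              ≈⟨ by-coeff-add (mul q p) (mul r p) (mul p q) (mul p r) n (+-cong (mul-comm q p n) (mul-comm r p n)) ⟩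
            coeff (add (mul p q) (mul p r)) n                  ∎) , λ p q r → coefficientwise (mul-distribʳ p q r)
        }
      ; *-comm = λ p q → coefficientwise (mul-comm p q)
      }
    }
    where
    by-coeff-add : ∀ p q p′ q′ n → coeff p n + coeff q n ≈ coeff p′ n + coeff q′ n →
                   coeff (add p q) n ≈ coeff (add p′ q′) n
    by-coeff-add p q p′ q′ n eq = trans (coeff-add p q n) (trans eq (sym (coeff-add p′ q′ n)))

    mul-comm : ∀ p q n → coeff (mul p q) n ≈ coeff (mul q p) n
    mul-comm p q n = trans (coeff-mul p q n) (trans (conv-comm (coeff p) (coeff q) n) (sym (coeff-mul q p n)))

    mul-identityˡ : ∀ p n → coeff (mul (1# ∷ []) p) n ≈ coeff p n
    mul-identityˡ p n = trans (coeff-constant-* 1# p n) (*-identityˡ _)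

    mul-distribʳ : ∀ p q r n → coeff (mul (add q r) p) n ≈ coeff (add (mul q p) (mul r p)) n
    mul-distribʳ p q r n = begin
      coeff (mul (add q r) p) n                                    ≈⟨ coeff-mul (add q r) p n ⟩
      conv (coeff (add q r)) (coeff p) n
        ≈⟨ conv-cong (λ i → trans (coeff-add q r i) (+-congʳ (sym (*-identityˡ _)))) (λ _ → refl) n ⟩
      conv (λ i → 1# * coeff q i + coeff r i) (coeff p) n          ≈⟨ conv-linear 1# (coeff q) (coeff r) (coeff p) n ⟩
      1# * conv (coeff q) (coeff p) n + conv (coeff r) (coeff p) n ≈⟨ +-congʳ (*-identityˡ _) ⟩
      conv (coeff q) (coeff p) n + conv (coeff r) (coeff p) n      ≈⟨ +-cong (coeff-mul q p n) (coeff-mul r p n) ⟨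
      coeff (mul q p) n + coeff (mul r p) n                        ≈⟨ coeff-add (mul q p) (mul r p) n ⟨
      coeff (add (mul q p) (mul r p)) n                            ∎

  module ℙ = CommutativeRing commutativeRing

  constant : Carrier → Poly
  constant a = a ∷ []

  indeterminate : Poly
  indeterminate = 0# ∷ 1# ∷ []

  constant-+ : ∀ a b → constant (a + b) ℙ.≈ constant a ℙ.+ constant b
  constant-+ a b = ℙ.refl

  constant-0 : constant 0# ℙ.≈ ℙ.0#
  constant-0 = coefficientwise λ { zero → refl ; (suc n) → refl }

  constant-cong : ∀ {a b} → a ≈ b → constant a ℙ.≈ constant b
  constant-cong a≈b = coefficientwise λ { zero → a≈b ; (suc n) → refl }

  constant-* : ∀ a b → constant (a * b) ℙ.≈ constant a ℙ.* constant b
  constant-* a b = coefficientwise λ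
    { zero    → sym (coeff-constant-* a (constant b) 0)
    ; (suc n) → sym (trans (coeff-constant-* a (constant b) (suc n)) (zeroʳ a))
    }

  shift : ∀ p → indeterminate ℙ.* p ℙ.≈ 0# ∷ p
  shift p = coefficientwise λ
    { zero    → trans (coeff-mul indeterminate p 0) (zeroˡ _)
    ; (suc n) → begin
        coeff (mul indeterminate p) (suc n)                        ≈⟨ coeff-mul indeterminate p (suc n) ⟩
        0# * coeff p (suc n) + conv (coeff (1# ∷ [])) (coeff p) n  ≈⟨ +-cong (zeroˡ _) (sym (coeff-mul (1# ∷ []) p n)) ⟩
        0# + coeff (mul (1# ∷ []) p) n                             ≈⟨ +-identityˡ _ ⟩
        coeff (mul (1# ∷ []) p) n                                  ≈⟨ coeff-constant-* 1# p n ⟩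
        1# * coeff p n                                             ≈⟨ *-identityˡ _ ⟩
        coeff p n                                                  ∎
    }

  module Substitution (q : Poly) where
    open IntegerCoefficients commutativeRing using (module Solver)
    open Solver using (solve; _:=_; _:+_; _:*_; con)

    -- Equal polynomials may be lists of different lengths; this disposes of the surplus zeros in
    -- `subst-cong`.
    subst-zero : ∀ p → p ℙ.≈ [] → compose p q ℙ.≈ []
    subst-zero []      p≈0 = ℙ.refl
    subst-zero (a ∷ p) p≈0 = ℙ.trans
      (ℙ.+-cong (ℙ.trans (constant-cong (at p≈0 0)) constant-0) (ℙ.*-congˡ {q} (subst-zero p (coefficientwise (at p≈0 ∘ suc)))))
      (solve 1 (λ q → con (+ 0) :+ q :* con (+ 0) := con (+ 0)) ℙ.refl q)

    subst-cong : ∀ p p′ → p ℙ.≈ p′ → compose p q ℙ.≈ compose p′ q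
    subst-cong []      p′       p≈p′ = ℙ.sym (subst-zero p′ (ℙ.sym p≈p′))
    subst-cong (a ∷ p) []       p≈p′ = subst-zero (a ∷ p) p≈p′
    subst-cong (a ∷ p) (b ∷ p′) p≈p′ =
      ℙ.+-cong (constant-cong (at p≈p′ 0)) (ℙ.*-congˡ {q} (subst-cong p p′ (coefficientwise (at p≈p′ ∘ suc))))

    subst-+ : ∀ p p′ → compose (p ℙ.+ p′) q ℙ.≈ compose p q ℙ.+ compose p′ q
    subst-+ []      p′       = ℙ.sym (ℙ.+-identityˡ (compose p′ q))
    subst-+ (a ∷ p) []       = ℙ.sym (ℙ.+-identityʳ (compose (a ∷ p) q))
    subst-+ (a ∷ p) (b ∷ p′) = ℙ.trans
      (ℙ.+-cong (constant-+ a b) (ℙ.*-congˡ {q} (subst-+ p p′)))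
      (solve 5 (λ a b q x y → (a :+ b) :+ q :* (x :+ y) := (a :+ q :* x) :+ (b :+ q :* y)) ℙ.refl
        (constant a) (constant b) q (compose p q) (compose p′ q))

    subst-shift : ∀ p → compose (0# ∷ p) q ℙ.≈ q ℙ.* compose p q
    subst-shift p = ℙ.trans (ℙ.+-congʳ {q ℙ.* compose p q} constant-0) (ℙ.+-identityˡ (q ℙ.* compose p q))

    subst-indeterminate : ∀ p → compose (indeterminate ℙ.* p) q ℙ.≈ q ℙ.* compose p q
    subst-indeterminate p = ℙ.trans (subst-cong (indeterminate ℙ.* p) (0# ∷ p) (shift p)) (subst-shift p)

    subst-scale : ∀ a p → compose (List.map (a *_) p) q ℙ.≈ constant a ℙ.* compose p q
    subst-scale a []      = ℙ.sym (ℙ.zeroʳ (constant a))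
    subst-scale a (b ∷ p) = ℙ.trans
      (ℙ.+-cong (constant-* a b) (ℙ.*-congˡ {q} (subst-scale a p)))
      (solve 4 (λ a b q x → a :* b :+ q :* (a :* x) := a :* (b :+ q :* x)) ℙ.refl
        (constant a) (constant b) q (compose p q))

    subst-constant-* : ∀ a p → compose (constant a ℙ.* p) q ℙ.≈ constant a ℙ.* compose p q
    subst-constant-* a p = ℙ.trans
      (subst-cong (constant a ℙ.* p) (List.map (a *_) p) (coefficientwise λ n → trans (coeff-constant-* a p n) (sym (coeff-map (a *_) (zeroʳ a) p n))))
      (subst-scale a p)

    subst-one : compose ℙ.1# q ℙ.≈ ℙ.1#
    subst-one = solve 1 (λ q → con (+ 1) :+ q :* con (+ 0) := con (+ 1)) ℙ.refl q

-- Exterior algebra, minors and Jacobi's identity.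

data Enumerates : ∀ {n k} → ℕ → Vec Bool n → (Fin k → ℕ) → Set where
  []   : ∀ {o} {s : Fin 0 → ℕ} → Enumerates o [] s
  skip : ∀ {n k o} {b : Vec Bool n} {s : Fin k → ℕ} →
         Enumerates (suc o) b s → Enumerates o (false ∷ b) s
  take : ∀ {n k o} {b : Vec Bool n} {s : Fin (suc k) → ℕ} →
         s zero ≡ o → Enumerates (suc o) b (s ∘ suc) → Enumerates o (true ∷ b) s

module ExteriorAlgebra {c ℓ : Level} (K : CommutativeRing c ℓ) where
  open CommutativeRing K hiding (zero)
  open IntegerCoefficients K using (module Solver)
  open Solver using (solve; _:=_; _:+_; _:*_; _:-_; :-_; con)
  open CommutativeMonoidSum +-commutativeMonoid using (sum; sum-cong-≋)
  open SemiringSum semiring using (*-distribˡ-sum)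
  open SemiringExponentiation semiring using (_^_)
  open Determinant rawRing using () renaming (det to detᴷ)
  open SetoidReasoning setoid

  Covector : Set c
  Covector = ℕ → Carrier

  -- The exterior algebra on n basis vectors: the word b stands for the wedge
  -- of the basis vectors at which b is true. The operations below read the
  -- coordinates of a covector from position o onwards.
  Form : ℕ → Set c
  Form n = Vec Bool n → Carrier

  infix 4 _≐_
  _≐_ : ∀ {n} → Form n → Form n → Set ℓ
  ω ≐ ω′ = ∀ b → ω b ≈ ω′ b

  infixr 6 _∧[_]_
  -- At a letter `true` either `v` supplies the basis vector at `o`, already in front, or `ω` does
  -- and `v` moves past it, which costs a sign.
  _∧[_]_ : ∀ {n} → Covector → ℕ → Form n → Form n
  (v ∧[ o ] ω) []          = 0#
  (v ∧[ o ] ω) (false ∷ b) = (v ∧[ suc o ] (ω ∘ (false ∷_))) b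
  (v ∧[ o ] ω) (true ∷ b)  = v o * ω (false ∷ b) - (v ∧[ suc o ] (ω ∘ (true ∷_))) b

  infixr 6 _⌟[_]_
  -- The usual contraction changes sign at each letter `true` that it passes, this one at each
  -- `false`. The two differ by the factor (-1)^d on the coordinate of `e` at `o + d`, which is the
  -- effect of X ↦ -X.
  _⌟[_]_ : ∀ {n} → Covector → ℕ → Form n → Form n
  (e ⌟[ o ] ω) []          = 0#
  (e ⌟[ o ] ω) (true ∷ b)  = (e ⌟[ suc o ] (ω ∘ (true ∷_))) b
  (e ⌟[ o ] ω) (false ∷ b) = e o * ω (true ∷ b) - (e ⌟[ suc o ] (ω ∘ (false ∷_))) b

  one : ∀ {n} → Form n
  one []          = 1#
  one (false ∷ b) = one b
  one (true ∷ b)  = 0#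

  top : ∀ {n} → Form n
  top []          = 1#
  top (true ∷ b)  = top b
  top (false ∷ b) = 0#

  ⋀ : ∀ {n k} → (Fin k → Covector) → ℕ → Form n
  ⋀ {k = zero}  u o = one
  ⋀ {k = suc k} u o = u zero ∧[ o ] ⋀ (u ∘ suc) o

  alternating-sum : (ℕ → Carrier) → ℕ → ℕ → Carrier
  alternating-sum x o zero    = 0#
  alternating-sum x o (suc n) = x o - alternating-sum x (suc o) n

  sign : ∀ {n} → Form n
  sign []          = 1#
  sign (true ∷ b)  = - sign b
  sign (false ∷ b) = sign b

  -- A homogeneous form satisfies this with ε = (-1)^degree, and the parity is all that matters when
  -- a covector is moved past the form.
  HasParity : ∀ {n} → Carrier → Form n → Set ℓ
  HasParity ε ω = ∀ b → sign b * ω b ≈ ε * ω b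

  ∧-cong : ∀ {n} {v v′ : Covector} o {ω ω′ : Form n} →
           (∀ k → v k ≈ v′ k) → ω ≐ ω′ → v ∧[ o ] ω ≐ v′ ∧[ o ] ω′
  ∧-cong o v≈ ω≐ []          = refl
  ∧-cong o v≈ ω≐ (false ∷ b) = ∧-cong (suc o) v≈ (ω≐ ∘ (false ∷_)) b
  ∧-cong o v≈ ω≐ (true ∷ b)  =
    +-cong (*-cong (v≈ o) (ω≐ (false ∷ b))) (-‿cong (∧-cong (suc o) v≈ (ω≐ ∘ (true ∷_)) b))

  ∧-linear : ∀ {n} v o x y (ω ω′ : Form n) →
             v ∧[ o ] (λ b → x * ω b + y * ω′ b) ≐ λ b → x * (v ∧[ o ] ω) b + y * (v ∧[ o ] ω′) b
  ∧-linear v o x y ω ω′ []          = solve 2 (λ x y → con (+ 0) := x :* con (+ 0) :+ y :* con (+ 0)) refl x y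
  ∧-linear v o x y ω ω′ (false ∷ b) = ∧-linear v (suc o) x y (ω ∘ (false ∷_)) (ω′ ∘ (false ∷_)) b
  ∧-linear v o x y ω ω′ (true ∷ b)  = trans
    (+-congˡ (-‿cong (∧-linear v (suc o) x y (ω ∘ (true ∷_)) (ω′ ∘ (true ∷_)) b)))
    (solve 7 (λ v x y p q r s → v :* (x :* p :+ y :* q) :- (x :* r :+ y :* s) :=
                                x :* (v :* p :- r) :+ y :* (v :* q :- s)) refl
      (v o) x y (ω (false ∷ b)) (ω′ (false ∷ b)) _ _)

  ∧-zeroʳ : ∀ {n} v o {ω : Form n} → (∀ b → ω b ≈ 0#) → ∀ b → (v ∧[ o ] ω) b ≈ 0#
  ∧-zeroʳ v o ω≈0 []          = refl
  ∧-zeroʳ v o ω≈0 (false ∷ b) = ∧-zeroʳ v (suc o) (ω≈0 ∘ (false ∷_)) b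
  ∧-zeroʳ v o ω≈0 (true ∷ b)  = trans
    (+-cong (*-congˡ (ω≈0 (false ∷ b))) (-‿cong (∧-zeroʳ v (suc o) (ω≈0 ∘ (true ∷_)) b)))
    (solve 1 (λ v → v :* con (+ 0) :- con (+ 0) := con (+ 0)) refl (v o))

  ∧-zeroˡ : ∀ {n} v o {ω : Form n} → (∀ k → o ℕ.≤ k → v k ≈ 0#) → ∀ b → (v ∧[ o ] ω) b ≈ 0#
  ∧-zeroˡ v o     v≈0 []          = refl
  ∧-zeroˡ v o     v≈0 (false ∷ b) = ∧-zeroˡ v (suc o) (λ k o<k → v≈0 k (ℕ.<⇒≤ o<k)) b
  ∧-zeroˡ v o {ω} v≈0 (true ∷ b)  = trans
    (+-cong (*-congʳ (v≈0 o ℕ.≤-refl)) (-‿cong (∧-zeroˡ v (suc o) (λ k o<k → v≈0 k (ℕ.<⇒≤ o<k)) b)))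
    (solve 1 (λ x → con (+ 0) :* x :- con (+ 0) := con (+ 0)) refl (ω (false ∷ b)))

  ∧-sum : ∀ {n k} v o (x : Fin k → Carrier) (ω : Fin k → Form n) →
          v ∧[ o ] (λ b → sum λ j → x j * ω j b) ≐ λ b → sum λ j → x j * (v ∧[ o ] ω j) b
  ∧-sum {k = zero}  v o x ω b = ∧-zeroʳ v o (λ _ → refl) b
  ∧-sum {k = suc k} v o x ω b = begin
    (v ∧[ o ] (λ b → x zero * ω zero b + rest b)) b                ≈⟨ ∧-cong o (λ _ → refl) (λ b → +-congˡ (*-identityˡ (rest b))) b ⟨
    (v ∧[ o ] (λ b → x zero * ω zero b + 1# * rest b)) b           ≈⟨ ∧-linear v o (x zero) 1# (ω zero) rest b ⟩
    x zero * (v ∧[ o ] ω zero) b + 1# * (v ∧[ o ] rest) b          ≈⟨ +-congˡ (*-identityˡ _) ⟩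
    x zero * (v ∧[ o ] ω zero) b + (v ∧[ o ] rest) b               ≈⟨ +-congˡ (∧-sum v o (x ∘ suc) (ω ∘ suc) b) ⟩
    (x zero * (v ∧[ o ] ω zero) b + sum λ j → x (suc j) * (v ∧[ o ] ω (suc j)) b) ∎
    where
    rest : Form _
    rest b = sum λ j → x (suc j) * ω (suc j) b

  ¬¬-word : ∀ {n} (b : Vec Bool n) → map not (map not b) ≡ b
  ¬¬-word b = ≡.trans (≡.sym (Vec.map-∘ not not b)) (≡.trans (Vec.map-cong not-involutive b) (Vec.map-id b))

  -- ∧ and ⌟ are exchanged by complementing words, with no sign because the
  -- signs of the coordinates are part of the definition of ⌟.
  ⌟-complement : ∀ {n} e o (ω : Form n) → e ⌟[ o ] ω ≐ λ b → (e ∧[ o ] (ω ∘ map not)) (map not b)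
  ⌟-complement e o ω []          = refl
  ⌟-complement e o ω (true ∷ b)  = ⌟-complement e (suc o) (ω ∘ (true ∷_)) b
  ⌟-complement e o ω (false ∷ b) = +-cong
    (*-congˡ (reflexive (≡.cong (ω ∘ (true ∷_)) (≡.sym (¬¬-word b)))))
    (-‿cong (⌟-complement e (suc o) (ω ∘ (false ∷_)) b))

  ⌟-cong : ∀ {n} e o {ω ω′ : Form n} → ω ≐ ω′ → e ⌟[ o ] ω ≐ e ⌟[ o ] ω′
  ⌟-cong e o ω≐ []          = refl
  ⌟-cong e o ω≐ (true ∷ b)  = ⌟-cong e (suc o) (ω≐ ∘ (true ∷_)) b
  ⌟-cong e o ω≐ (false ∷ b) =
    +-cong (*-congˡ (ω≐ (true ∷ b))) (-‿cong (⌟-cong e (suc o) (ω≐ ∘ (false ∷_)) b))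

  ⌟-linear : ∀ {n} e o x (ω ω′ : Form n) →
             e ⌟[ o ] (λ b → x * ω b - ω′ b) ≐ λ b → x * (e ⌟[ o ] ω) b - (e ⌟[ o ] ω′) b
  ⌟-linear e o x ω ω′ []          = solve 1 (λ x → con (+ 0) := x :* con (+ 0) :- con (+ 0)) refl x
  ⌟-linear e o x ω ω′ (true ∷ b)  = ⌟-linear e (suc o) x (ω ∘ (true ∷_)) (ω′ ∘ (true ∷_)) b
  ⌟-linear e o x ω ω′ (false ∷ b) = trans
    (+-congˡ (-‿cong (⌟-linear e (suc o) x (ω ∘ (false ∷_)) (ω′ ∘ (false ∷_)) b)))
    (solve 6 (λ e x p q r s → e :* (x :* p :- q) :- (x :* r :- s) :=
                              x :* (e :* p :- r) :- (e :* q :- s)) refl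
      (e o) x (ω (true ∷ b)) (ω′ (true ∷ b)) _ _)

  ⌟-zeroʳ : ∀ {n} e o {ω : Form n} → (∀ b → ω b ≈ 0#) → ∀ b → (e ⌟[ o ] ω) b ≈ 0#
  ⌟-zeroʳ e o ω≈0 b = trans (⌟-complement e o _ b) (∧-zeroʳ e o (ω≈0 ∘ map not) (map not b))

  ∧-sub : ∀ {n} v o x (ω ω′ : Form n) →
          v ∧[ o ] (λ b → x * ω b - ω′ b) ≐ λ b → x * (v ∧[ o ] ω) b - (v ∧[ o ] ω′) b
  ∧-sub v o x ω ω′ b = trans
    (∧-cong o (λ _ → refl) (λ b → +-congˡ (minus (ω′ b))) b)
    (trans (∧-linear v o x (- 1#) ω ω′ b) (+-congˡ (sym (minus _))))
    where
    minus : ∀ y → - y ≈ - 1# * y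
    minus = solve 1 (λ y → :- y := :- con (+ 1) :* y) refl

  -- Contraction is an antiderivation; the signs carried by the coordinates of `e` make its scalar
  -- term an alternating sum.
  leibniz : ∀ {n} e u o (ω : Form n) →
    e ⌟[ o ] (u ∧[ o ] ω) ≐ λ b → alternating-sum (λ k → u k * e k) o n * ω b - (u ∧[ o ] (e ⌟[ o ] ω)) b
  leibniz e u o ω [] = solve 1 (λ x → con (+ 0) := con (+ 0) :* x :- con (+ 0)) refl (ω [])
  leibniz {suc n} e u o ω (true ∷ b) = begin
    (e ⌟[ suc o ] (λ c → u o * ω (false ∷ c) - (u ∧[ suc o ] (ω ∘ (true ∷_))) c)) b
      ≈⟨ ⌟-linear e (suc o) (u o) _ _ b ⟩
    u o * κ - (e ⌟[ suc o ] (u ∧[ suc o ] (ω ∘ (true ∷_)))) b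
      ≈⟨ +-congˡ (-‿cong (leibniz e u (suc o) (ω ∘ (true ∷_)) b)) ⟩
    u o * κ - (p * ω (true ∷ b) - (u ∧[ suc o ] (e ⌟[ suc o ] (ω ∘ (true ∷_)))) b)
      ≈⟨ solve 6 (λ u e t k p z → u :* k :- (p :* t :- z) := (u :* e :- p) :* t :- (u :* (e :* t :- k) :- z)) refl
           (u o) (e o) (ω (true ∷ b)) κ p _ ⟩
    (u o * e o - p) * ω (true ∷ b) - (u o * (e o * ω (true ∷ b) - κ) - (u ∧[ suc o ] (e ⌟[ suc o ] (ω ∘ (true ∷_)))) b) ∎
    where
    κ = (e ⌟[ suc o ] (ω ∘ (false ∷_))) b
    p = alternating-sum (λ k → u k * e k) (suc o) n
  leibniz {suc n} e u o ω (false ∷ b) = begin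
    e o * (u o * ω (false ∷ b) - τ) - (e ⌟[ suc o ] (u ∧[ suc o ] (ω ∘ (false ∷_)))) b
      ≈⟨ +-congˡ (-‿cong (leibniz e u (suc o) (ω ∘ (false ∷_)) b)) ⟩
    e o * (u o * ω (false ∷ b) - τ) - (p * ω (false ∷ b) - z)
      ≈⟨ solve 6 (λ u e f t p z → e :* (u :* f :- t) :- (p :* f :- z) := (u :* e :- p) :* f :- (e :* t :- z)) refl
           (u o) (e o) (ω (false ∷ b)) τ p z ⟩
    (u o * e o - p) * ω (false ∷ b) - (e o * τ - z)
      ≈⟨ +-congˡ (-‿cong (∧-sub u (suc o) (e o) _ _ b)) ⟨
    (u o * e o - p) * ω (false ∷ b) - (u ∧[ suc o ] (λ c → e o * ω (true ∷ c) - (e ⌟[ suc o ] (ω ∘ (false ∷_))) c)) b ∎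
    where
    τ = (u ∧[ suc o ] (ω ∘ (true ∷_))) b
    p = alternating-sum (λ k → u k * e k) (suc o) n
    z = (u ∧[ suc o ] (e ⌟[ suc o ] (ω ∘ (false ∷_)))) b

  ∧-∷ʳ-false : ∀ {n} v o (ω : Form (suc n)) b → (v ∧[ o ] ω) (b ∷ʳ false) ≈ (v ∧[ o ] (ω ∘ (_∷ʳ false))) b
  ∧-∷ʳ-false v o ω []          = refl
  ∧-∷ʳ-false v o ω (false ∷ b) = ∧-∷ʳ-false v (suc o) (ω ∘ (false ∷_)) b
  ∧-∷ʳ-false v o ω (true ∷ b)  = +-congˡ (-‿cong (∧-∷ʳ-false v (suc o) (ω ∘ (true ∷_)) b))

  -- If `v` supplies the last basis vector, that vector has to pass all those of `b`, hence the
  -- factor `sign b`.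
  ∧-∷ʳ-true : ∀ {n} v o (ω : Form (suc n)) b →
    (v ∧[ o ] ω) (b ∷ʳ true) ≈ (v ∧[ o ] (ω ∘ (_∷ʳ true))) b + sign b * (v (o ℕ.+ n) * ω (b ∷ʳ false))
  ∧-∷ʳ-true v o ω [] rewrite ℕ.+-identityʳ o =
    solve 2 (λ v x → v :* x :- con (+ 0) := con (+ 0) :+ con (+ 1) :* (v :* x)) refl (v o) (ω (false ∷ []))
  ∧-∷ʳ-true {suc n} v o ω (false ∷ b) rewrite ℕ.+-suc o n = ∧-∷ʳ-true v (suc o) (ω ∘ (false ∷_)) b
  ∧-∷ʳ-true {suc n} v o ω (true ∷ b)  rewrite ℕ.+-suc o n = trans
    (+-congˡ (-‿cong (∧-∷ʳ-true v (suc o) (ω ∘ (true ∷_)) b)))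
    (solve 4 (λ p q s r → p :- (q :+ s :* r) := (p :- q) :+ :- s :* r) refl
      (v o * ω (false ∷ (b ∷ʳ true))) _ (sign b) _)

  sign-∷ʳ : ∀ {n} x (b : Vec Bool n) → sign (b ∷ʳ x) ≈ sign (x ∷ b)
  sign-∷ʳ false []          = refl
  sign-∷ʳ true  []          = refl
  sign-∷ʳ x     (false ∷ b) = trans (sign-∷ʳ x b) (swap x)
    where
    swap : ∀ x → sign (x ∷ b) ≈ sign (x ∷ false ∷ b)
    swap false = refl
    swap true  = refl
  sign-∷ʳ x     (true ∷ b)  = trans (-‿cong (sign-∷ʳ x b)) (swap x)
    where
    swap : ∀ x → - sign (x ∷ b) ≈ sign (x ∷ true ∷ b)
    swap false = refl
    swap true  = refl

  sign-reverse : ∀ {n} (b : Vec Bool n) → sign (reverse b) ≈ sign b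
  sign-reverse []      = refl
  sign-reverse (x ∷ b) = begin
    sign (reverse (x ∷ b))  ≡⟨ ≡.cong sign (Vec.reverse-∷ x b) ⟩
    sign (reverse b ∷ʳ x)   ≈⟨ sign-∷ʳ x (reverse b) ⟩
    sign (x ∷ reverse b)    ≈⟨ step x ⟩
    sign (x ∷ b)            ∎
    where
    step : ∀ x → sign (x ∷ reverse b) ≈ sign (x ∷ b)
    step false = sign-reverse b
    step true  = -‿cong (sign-reverse b)

  parity-one : ∀ {n} → HasParity {n} 1# one
  parity-one []          = refl
  parity-one (false ∷ b) = parity-one b
  parity-one (true ∷ b)  = solve 1 (λ s → s :* con (+ 0) := con (+ 1) :* con (+ 0)) refl _

  parity-false : ∀ {n ε} {ω : Form (suc n)} → HasParity ε ω → HasParity ε (ω ∘ (false ∷_))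
  parity-false h b = h (false ∷ b)

  parity-true : ∀ {n ε} {ω : Form (suc n)} → HasParity ε ω → HasParity (- ε) (ω ∘ (true ∷_))
  parity-true {ε = ε} {ω} h b = begin
    sign b * ω (true ∷ b)         ≈⟨ solve 2 (λ s x → s :* x := :- (:- s :* x)) refl _ _ ⟩
    - (- sign b * ω (true ∷ b))   ≈⟨ -‿cong (h (true ∷ b)) ⟩
    - (ε * ω (true ∷ b))          ≈⟨ solve 2 (λ s x → :- (s :* x) := :- s :* x) refl _ _ ⟩
    - ε * ω (true ∷ b)            ∎

  parity-∧ : ∀ {n} v o {ε} {ω : Form n} → HasParity ε ω → HasParity (- ε) (v ∧[ o ] ω)
  parity-∧ v o {ε} h [] = solve 1 (λ e → con (+ 1) :* con (+ 0) := :- e :* con (+ 0)) refl ε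
  parity-∧ v o h (false ∷ b) = parity-∧ v (suc o) (parity-false h) b
  parity-∧ v o {ε} {ω} h (true ∷ b) = begin
    - sign b * (v o * ω (false ∷ b) - τ)
      ≈⟨ solve 4 (λ s v x t → :- s :* (v :* x :- t) := :- (v :* (s :* x)) :+ s :* t) refl (sign b) (v o) _ τ ⟩
    - (v o * (sign b * ω (false ∷ b))) + sign b * τ
      ≈⟨ +-cong (-‿cong (*-congˡ (h (false ∷ b)))) (parity-∧ v (suc o) (parity-true {ε = ε} {ω} h) b) ⟩
    - (v o * (ε * ω (false ∷ b))) + - (- ε) * τ
      ≈⟨ solve 4 (λ s v x t → :- (v :* (s :* x)) :+ :- (:- s) :* t := :- s :* (v :* x :- t)) refl ε (v o) _ τ ⟩
    - ε * (v o * ω (false ∷ b) - τ) ∎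
    where τ = (v ∧[ suc o ] (ω ∘ (true ∷_))) b

  -- Reversal of words is an anti-automorphism of the exterior algebra: it carries `v` from the
  -- front of the product to the back. Moving it to the front again, past a form of parity `ε`,
  -- costs `ε`.
  ∧-reverse : ∀ {n} {v v̄ : Covector} o {ε} (ω ω̄ : Form n) →
    (∀ i j → i ℕ.+ suc j ≡ o ℕ.+ n → v̄ i ≈ v j) → HasParity ε ω → ω̄ ∘ reverse ≐ ω →
    (v̄ ∧[ 0 ] ω̄) ∘ reverse ≐ λ b → ε * (v ∧[ o ] ω) b
  ∧-reverse o {ε} ω ω̄ v̄≈v h ω̄≐ω [] = solve 1 (λ e → con (+ 0) := e :* con (+ 0)) refl ε
  ∧-reverse {suc n} {v} {v̄} o {ε} ω ω̄ v̄≈v h ω̄≐ω (false ∷ b) = begin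
    (v̄ ∧[ 0 ] ω̄) (reverse (false ∷ b))           ≡⟨ ≡.cong (v̄ ∧[ 0 ] ω̄) (Vec.reverse-∷ false b) ⟩
    (v̄ ∧[ 0 ] ω̄) (reverse b ∷ʳ false)            ≈⟨ ∧-∷ʳ-false v̄ 0 ω̄ (reverse b) ⟩
    (v̄ ∧[ 0 ] (ω̄ ∘ (_∷ʳ false))) (reverse b)
      ≈⟨ ∧-reverse (suc o) (ω ∘ (false ∷_)) (ω̄ ∘ (_∷ʳ false))
           (λ i j eq → v̄≈v i j (≡.trans eq (≡.sym (ℕ.+-suc o n))))
           (parity-false h)
           (λ b → trans (reflexive (≡.cong ω̄ (≡.sym (Vec.reverse-∷ false b)))) (ω̄≐ω (false ∷ b))) b ⟩
    ε * (v ∧[ suc o ] (ω ∘ (false ∷_))) b        ∎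
  ∧-reverse {suc n} {v} {v̄} o {ε} ω ω̄ v̄≈v h ω̄≐ω (true ∷ b) = begin
    (v̄ ∧[ 0 ] ω̄) (reverse (true ∷ b))            ≡⟨ ≡.cong (v̄ ∧[ 0 ] ω̄) (Vec.reverse-∷ true b) ⟩
    (v̄ ∧[ 0 ] ω̄) (reverse b ∷ʳ true)             ≈⟨ ∧-∷ʳ-true v̄ 0 ω̄ (reverse b) ⟩
    (v̄ ∧[ 0 ] (ω̄ ∘ (_∷ʳ true))) (reverse b) + sign (reverse b) * (v̄ n * ω̄ (reverse b ∷ʳ false))
      ≈⟨ +-cong
           (∧-reverse (suc o) (ω ∘ (true ∷_)) (ω̄ ∘ (_∷ʳ true))
             (λ i j eq → v̄≈v i j (≡.trans eq (≡.sym (ℕ.+-suc o n))))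
             (parity-true {ε = ε} {ω} h)
             (λ b → trans (reflexive (≡.cong ω̄ (≡.sym (Vec.reverse-∷ true b)))) (ω̄≐ω (true ∷ b))) b)
           (*-cong (sign-reverse b)
             (*-cong (v̄≈v n o (ℕ.+-comm n (suc o) ⟨ ≡.trans ⟩ ≡.sym (ℕ.+-suc o n)))
                     (trans (reflexive (≡.cong ω̄ (≡.sym (Vec.reverse-∷ false b)))) (ω̄≐ω (false ∷ b))))) ⟩
    - ε * τ + sign b * (v o * ω (false ∷ b))
      ≈⟨ solve 5 (λ e t s v x → :- e :* t :+ s :* (v :* x) := v :* (s :* x) :- e :* t) refl ε τ (sign b) (v o) _ ⟩
    v o * (sign b * ω (false ∷ b)) - ε * τ       ≈⟨ +-congʳ (*-congˡ (h (false ∷ b))) ⟩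
    v o * (ε * ω (false ∷ b)) - ε * τ
      ≈⟨ solve 4 (λ e t v x → v :* (e :* x) :- e :* t := e :* (v :* x :- t)) refl ε τ (v o) _ ⟩
    ε * (v o * ω (false ∷ b) - τ)                ∎
    where
    τ = (v ∧[ suc o ] (ω ∘ (true ∷_))) b

  ⋀-false : ∀ {n k} (u : Fin k → Covector) o (b : Vec Bool n) → ⋀ u o (false ∷ b) ≈ ⋀ u (suc o) b
  ⋀-false {k = zero}  u o b = refl
  ⋀-false {k = suc k} u o b = ∧-cong (suc o) (λ _ → refl) (⋀-false (u ∘ suc) o) b

  ⋀-cong : ∀ {n k} {u u′ : Fin k → Covector} o → (∀ i x → u i x ≈ u′ i x) → ⋀ {n} u o ≐ ⋀ u′ o
  ⋀-cong {k = zero}  o u≈u′ b = refl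
  ⋀-cong {k = suc k} o u≈u′ b = ∧-cong o (u≈u′ zero) (⋀-cong o (u≈u′ ∘ suc)) b

  -- From `o` onwards the first vector has the single coordinate 1 at `o`. Once that position is
  -- taken, the remaining vectors are read from `suc o`, where they have the same shape.
  ⋀-unitriangular : ∀ {n} (u : Fin n → Covector) o →
    (∀ i {x} → x ≡ o ℕ.+ toℕ i → u i x ≈ 1#) → (∀ i {x} → o ℕ.+ toℕ i < x → u i x ≈ 0#) →
    (b : Vec Bool n) → ⋀ u o b ≈ top b
  ⋀-unitriangular u o u≈1 u≈0 []          = refl
  ⋀-unitriangular u o u≈1 u≈0 (false ∷ b) = ∧-zeroˡ (u zero) (suc o)
    (λ k o<k → u≈0 zero (ℕ.≤-trans (s≤s (ℕ.≤-reflexive (ℕ.+-identityʳ o))) o<k)) b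
  ⋀-unitriangular u o u≈1 u≈0 (true ∷ b)  = begin
    u zero o * ⋀ (u ∘ suc) o (false ∷ b) - (u zero ∧[ suc o ] (⋀ (u ∘ suc) o ∘ (true ∷_))) b
      ≈⟨ +-cong (*-cong (u≈1 zero (≡.sym (ℕ.+-identityʳ o))) (⋀-false (u ∘ suc) o b))
           (-‿cong (∧-zeroˡ (u zero) (suc o)
             (λ k o<k → u≈0 zero (ℕ.≤-trans (s≤s (ℕ.≤-reflexive (ℕ.+-identityʳ o))) o<k)) b)) ⟩
    1# * ⋀ (u ∘ suc) (suc o) b - 0#
      ≈⟨ solve 1 (λ x → con (+ 1) :* x :- con (+ 0) := x) refl _ ⟩
    ⋀ (u ∘ suc) (suc o) b
      ≈⟨ ⋀-unitriangular (u ∘ suc) (suc o)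
           (λ i x≡ → u≈1 (suc i) (≡.trans x≡ (≡.sym (ℕ.+-suc o (toℕ i)))))
           (λ i <x → u≈0 (suc i) (ℕ.≤-trans (s≤s (ℕ.≤-reflexive (ℕ.+-suc o (toℕ i)))) <x)) b ⟩
    top b ∎

  ⌟-one : ∀ {n} e o (b : Vec Bool n) → (e ⌟[ o ] one) b ≈ 0#
  ⌟-one e o []          = refl
  ⌟-one e o (true ∷ b)  = ⌟-zeroʳ e (suc o) (λ _ → refl) b
  ⌟-one e o (false ∷ b) = trans (+-congˡ (-‿cong (⌟-one e (suc o) b)))
    (solve 1 (λ x → x :* con (+ 0) :- con (+ 0) := con (+ 0)) refl (e o))

  ⌟-⋀-orthogonal : ∀ {n k} e o (u : Fin k → Covector) →
    (∀ i → alternating-sum (λ x → u i x * e x) o n ≈ 0#) → (b : Vec Bool n) → (e ⌟[ o ] ⋀ u o) b ≈ 0#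
  ⌟-⋀-orthogonal {k = zero}  e o u e⊥u b = ⌟-one e o b
  ⌟-⋀-orthogonal {n} {suc k} e o u e⊥u b = begin
    (e ⌟[ o ] (u zero ∧[ o ] ⋀ (u ∘ suc) o)) b  ≈⟨ leibniz e (u zero) o _ b ⟩
    alternating-sum (λ x → u zero x * e x) o n * ⋀ (u ∘ suc) o b - (u zero ∧[ o ] (e ⌟[ o ] ⋀ (u ∘ suc) o)) b
      ≈⟨ +-cong (*-congʳ (e⊥u zero)) (-‿cong (∧-zeroʳ (u zero) o (⌟-⋀-orthogonal e o (u ∘ suc) (e⊥u ∘ suc)) b)) ⟩
    0# * ⋀ (u ∘ suc) o b - 0#                    ≈⟨ solve 1 (λ x → con (+ 0) :* x :- con (+ 0) := con (+ 0)) refl _ ⟩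
    0#                                           ∎

  -- Some `u j` supplies the basis vector at `o`, and passing the `j` vectors before it gives the
  -- sign. This is the expansion that defines `det`, with positions as rows and covectors as
  -- columns.
  ⋀-laplace : ∀ {n k} (u : Fin (suc k) → Covector) o (b : Vec Bool n) →
    ⋀ u o (true ∷ b) ≈ sum λ j → ((- 1#) ^ toℕ j) * (u j o * ⋀ (λ i → u (punchIn j i)) (suc o) b)
  ⋀-laplace {k = zero} u o b = trans
    (+-congˡ (-‿cong (∧-zeroʳ (u zero) (suc o) (λ _ → refl) b)))
    (solve 2 (λ x y → x :* y :- con (+ 0) := con (+ 1) :* (x :* y) :+ con (+ 0)) refl (u zero o) (one b))
  ⋀-laplace {n} {suc k} u o b = +-cong
    (trans (*-congˡ (⋀-false (u ∘ suc) o b)) (sym (*-identityˡ _)))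
    (begin
      - (u zero ∧[ suc o ] (⋀ (u ∘ suc) o ∘ (true ∷_))) b
        ≈⟨ -‿cong (∧-cong (suc o) (λ _ → refl) laplace b) ⟩
      - (u zero ∧[ suc o ] (λ b → sum λ j → x j * ω j b)) b
        ≈⟨ -‿cong (∧-sum (u zero) (suc o) x ω b) ⟩
      - (sum λ j → x j * (u zero ∧[ suc o ] ω j) b)
        ≈⟨ solve 1 (λ y → :- y := :- con (+ 1) :* y) refl _ ⟩
      - 1# * (sum λ j → x j * (u zero ∧[ suc o ] ω j) b)
        ≈⟨ *-distribˡ-sum (- 1#) (λ j → x j * (u zero ∧[ suc o ] ω j) b) ⟩
      (sum λ j → - 1# * (x j * (u zero ∧[ suc o ] ω j) b))
        ≈⟨ (sum-cong-≋ λ j → solve 4 (λ m s y z → m :* (s :* y :* z) := m :* s :* (y :* z)) refl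
             (- 1#) ((- 1#) ^ toℕ j) (u (suc j) o) ((u zero ∧[ suc o ] ω j) b)) ⟩
      (sum λ j → ((- 1#) ^ suc (toℕ j)) * (u (suc j) o * (u zero ∧[ suc o ] ω j) b)) ∎)
    where
    x : Fin (suc k) → Carrier
    x j = ((- 1#) ^ toℕ j) * u (suc j) o
    ω : Fin (suc k) → Form n
    ω j = ⋀ (λ i → u (suc (punchIn j i))) (suc o)
    laplace : ⋀ (u ∘ suc) o ∘ (true ∷_) ≐ λ b → sum λ j → x j * ω j b
    laplace b = trans (⋀-laplace (u ∘ suc) o b)
      (sum-cong-≋ λ j → sym (*-assoc ((- 1#) ^ toℕ j) (u (suc j) o) (ω j b)))

  -- `Enumerates` is a relation that follows the word letter by letter: each `true` is one Laplace
  -- step, while the row positions `s` may still be given by a closed formula such as the one for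
  -- the boundary of a partition.
  ⋀-minor : ∀ {n k o} {b : Vec Bool n} {s : Fin k → ℕ} (u : Fin k → Covector) →
            Enumerates o b s → ⋀ u o b ≈ detᴷ λ i j → u j (s i)
  ⋀-minor {o = o} u []               = refl
  ⋀-minor {k = zero} {o} {false ∷ b} u (skip p) = ⋀-minor u p
  ⋀-minor {k = suc k} {o} {false ∷ b} u (skip p) = trans (⋀-false u o b) (⋀-minor u p)
  ⋀-minor {o = o} {true ∷ b} u (take s₀≡o p)     = trans (⋀-laplace u o b) (sum-cong-≋ λ j →
    *-congˡ {x = (- 1#) ^ toℕ j}
      (*-cong (reflexive (≡.cong (u j) (≡.sym s₀≡o))) (⋀-minor (λ i → u (punchIn j i)) p)))

  -- Each contraction puts the next covector in front of the earlier ones, so after `j` steps they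
  -- stand in the order j - 1, ..., 0.
  countdown : ∀ j → Fin j → ℕ
  countdown (suc j) zero    = j
  countdown (suc j) (suc i) = countdown j i

  one-complement : ∀ {n} (b : Vec Bool n) → one (map not b) ≈ top b
  one-complement []          = refl
  one-complement (false ∷ b) = refl
  one-complement (true ∷ b)  = one-complement b

  one-∷ʳ-false : ∀ {n} (b : Vec Bool n) → one (b ∷ʳ false) ≈ one b
  one-∷ʳ-false []          = refl
  one-∷ʳ-false (false ∷ b) = one-∷ʳ-false b
  one-∷ʳ-false (true ∷ b)  = refl

  one-∷ʳ-true : ∀ {n} (b : Vec Bool n) → one (b ∷ʳ true) ≈ 0#
  one-∷ʳ-true []          = refl
  one-∷ʳ-true (false ∷ b) = one-∷ʳ-true b
  one-∷ʳ-true (true ∷ b)  = refl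

  one-reverse : ∀ {n} (b : Vec Bool n) → one (reverse b) ≈ one b
  one-reverse []          = refl
  one-reverse (false ∷ b) = trans (reflexive (≡.cong one (Vec.reverse-∷ false b)))
                                  (trans (one-∷ʳ-false (reverse b)) (one-reverse b))
  one-reverse (true ∷ b)  = trans (reflexive (≡.cong one (Vec.reverse-∷ true b))) (one-∷ʳ-true (reverse b))

  −1^j-squared : ∀ j → ((- 1#) ^ j) * ((- 1#) ^ j) ≈ 1#
  −1^j-squared zero    = *-identityˡ 1#
  −1^j-squared (suc j) = trans
    (solve 1 (λ x → (:- con (+ 1) :* x) :* (:- con (+ 1) :* x) := x :* x) refl _) (−1^j-squared j)

  -- Jacobi's identity for complementary minors of a unitriangular matrix and
  -- of its inverse. Contracting u₀ ∧ ⋯ ∧ uₙ₋₁ = top with e₀, e₁, … strips off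
  -- u₀, u₁, …; the sign (-1)^j of each step is the one produced by reversing
  -- the order of the coordinates of e j, so that no sign remains.
  module _ {n : ℕ} (u e ē : ℕ → Covector)
    (u≈1 : ∀ i → u i i ≈ 1#) (u≈0 : ∀ {i x} → i < x → u i x ≈ 0#)
    (self : ∀ j → j < n → alternating-sum (λ x → u j x * e j x) 0 n ≈ (- 1#) ^ j)
    (orthogonal : ∀ {i j} → j < i → i < n → alternating-sum (λ x → u i x * e j x) 0 n ≈ 0#)
    (e-reversed : ∀ j {i x} → i ℕ.+ suc x ≡ n → ē j i ≈ e j x)
    where

    private
      Ω : ∀ j m → Form n
      Ω j m = ⋀ {k = m} (λ i → u (j ℕ.+ toℕ i)) 0

      Θ : ∀ j → Form n
      Θ j = ⋀ {k = j} (λ i → ē (countdown j i)) 0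

    parity-Θ : ∀ j → HasParity ((- 1#) ^ j) (Θ j)
    parity-Θ zero    = parity-one
    parity-Θ (suc j) b = trans (parity-∧ (ē j) 0 (parity-Θ j) b)
      (*-congʳ (solve 1 (λ x → :- x := :- con (+ 1) :* x) refl _))

    complementary-forms : ∀ j m → j ℕ.+ m ≡ n → Ω j m ≐ λ b → Θ j (reverse (map not b))
    complementary-forms zero m ≡.refl b = begin
      Ω 0 m b                       ≈⟨ ⋀-unitriangular {m} (λ i → u (toℕ i)) 0
                                         (λ i x≡ → trans (reflexive (≡.cong (u (toℕ i)) x≡)) (u≈1 (toℕ i)))
                                         (λ i i<x → u≈0 i<x) b ⟩
      top b                         ≈⟨ one-complement b ⟨
      one (map not b)               ≈⟨ one-reverse (map not b) ⟨
      one (reverse (map not b))     ∎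
    complementary-forms (suc j) m j+m≡n b = begin
      Ω (suc j) m b                              ≈⟨ *-identityˡ _ ⟨
      -- One `ε` is the pairing of `u j` with `e j` in `strip`, the other is consumed by
      -- `∧-reverse`.
      1# * Ω (suc j) m b                         ≈⟨ *-congʳ (−1^j-squared j) ⟨
      (ε * ε) * Ω (suc j) m b                    ≈⟨ *-assoc ε ε _ ⟩
      ε * (ε * Ω (suc j) m b)                    ≈⟨ *-congˡ strip ⟨
      ε * (e j ⌟[ 0 ] Ω j (suc m)) b             ≈⟨ *-congˡ (⌟-complement (e j) 0 (Ω j (suc m)) b) ⟩
      ε * (e j ∧[ 0 ] Ω̃) (map not b)
        ≈⟨ ∧-reverse 0 Ω̃ (Θ j) (λ i x → e-reversed j) parity Θ≐Ω̃ (map not b) ⟨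
      Θ (suc j) (reverse (map not b))            ∎
      where
      ε = (- 1#) ^ j
      Ω̃ = Ω j (suc m) ∘ map not

      j+1+m≡n : j ℕ.+ suc m ≡ n
      j+1+m≡n = ≡.trans (ℕ.+-suc j m) j+m≡n

      Ω-tail : ⋀ {k = m} (λ i → u (j ℕ.+ suc (toℕ i))) 0 ≐ Ω (suc j) m
      Ω-tail = ⋀-cong {k = m} 0 λ i x → reflexive (≡.cong (λ y → u y x) (ℕ.+-suc j (toℕ i)))

      strip : (e j ⌟[ 0 ] Ω j (suc m)) b ≈ ε * Ω (suc j) m b
      strip = begin
        (e j ⌟[ 0 ] Ω j (suc m)) b
          ≈⟨ ⌟-cong (e j) 0 (∧-cong 0 (λ x → reflexive (≡.cong (λ y → u y x) (ℕ.+-identityʳ j))) Ω-tail) b ⟩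
        (e j ⌟[ 0 ] (u j ∧[ 0 ] Ω (suc j) m)) b
          ≈⟨ leibniz (e j) (u j) 0 (Ω (suc j) m) b ⟩
        alternating-sum (λ x → u j x * e j x) 0 n * Ω (suc j) m b - (u j ∧[ 0 ] (e j ⌟[ 0 ] Ω (suc j) m)) b
          ≈⟨ +-cong (*-congʳ (self j j<n)) (-‿cong (∧-zeroʳ (u j) 0 (⌟-⋀-orthogonal (e j) 0 (λ i → u (suc j ℕ.+ toℕ i))
               (λ i → orthogonal (s≤s (ℕ.m≤m+n j (toℕ i))) (i<n i))) b)) ⟩
        ε * Ω (suc j) m b - 0#
          ≈⟨ solve 1 (λ x → x :- con (+ 0) := x) refl _ ⟩
        ε * Ω (suc j) m b ∎
        where
        j<n : j < n
        j<n = ℕ.≤-trans (ℕ.m≤m+n (suc j) m) (ℕ.≤-reflexive j+m≡n)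
        i<n : ∀ i → suc j ℕ.+ toℕ i < n
        i<n i = ℕ.≤-trans (ℕ.+-monoʳ-< (suc j) (Fin.toℕ<n i)) (ℕ.≤-reflexive j+m≡n)

      Θ≐Ω̃ : Θ j ∘ reverse ≐ Ω̃
      Θ≐Ω̃ b = sym (trans (complementary-forms j (suc m) j+1+m≡n (map not b))
                         (reflexive (≡.cong (Θ j ∘ reverse) (¬¬-word b))))

      parity : HasParity ε Ω̃
      parity b = trans (*-cong (sym (sign-reverse b)) (sym (Θ≐Ω̃ b)))
                       (trans (parity-Θ j (reverse b)) (*-congˡ (Θ≐Ω̃ b)))

    complementary-minors : ∀ {j m} {b : Vec Bool n} {s : Fin m → ℕ} {r : Fin j → ℕ} → j ℕ.+ m ≡ n →
      Enumerates 0 b s → Enumerates 0 (reverse (map not b)) r →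
      detᴷ (λ i k → u (j ℕ.+ toℕ k) (s i)) ≈ detᴷ (λ i k → ē (countdown j k) (r i))
    complementary-minors {j} {m} {b} {s} {r} j+m≡n s-rows r-rows = begin
      detᴷ (λ i k → u (j ℕ.+ toℕ k) (s i))        ≈⟨ ⋀-minor (λ k → u (j ℕ.+ toℕ k)) s-rows ⟨
      Ω j m b                                ≈⟨ complementary-forms j m j+m≡n b ⟩
      Θ j (reverse (map not b))              ≈⟨ ⋀-minor (λ k → ē (countdown j k)) r-rows ⟩
      detᴷ (λ i k → ē (countdown j k) (r i))      ∎

-- Truncated sums and the duality between t and 1 - t.

module TruncatedSums {c ℓ : Level} (K : CommutativeRing c ℓ) where
  open CommutativeRing K hiding (zero)
  open ExteriorAlgebra K using (alternating-sum)
  open IntegerCoefficients K using (module Solver)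
  open Solver using (solve; _:=_; _:+_; _:*_; _:-_; :-_; con)
  open SemiringExponentiation semiring using (_^_)
  open SetoidReasoning setoid

  module _ (t : Carrier) (y : ℕ → ℕ → Carrier) where

    -- With y N d = 1/(N+1)^k_{d+1}, these are the sums of
    -- t^e(m) / (m₁^k₁ ⋯ m_d^k_d) over 0 < m₁ ≤ ⋯ ≤ m_d with m_d ≤ N,
    -- respectively m_d = N + 1.
    upTo : ℕ → ℕ → Carrier
    endingAt : ℕ → ℕ → Carrier
    upTo _       zero    = 1#
    upTo zero    (suc d) = 0#
    upTo (suc N) (suc d) = upTo N (suc d) + endingAt N (suc d)
    endingAt N zero    = 0#
    endingAt N (suc d) = y N d * (upTo N d + t * endingAt N d)

    upTo-suc : ∀ N d → upTo (suc N) d ≈ upTo N d + endingAt N d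
    upTo-suc N zero    = sym (+-identityʳ 1#)
    upTo-suc N (suc d) = refl

  -- Extending `f` by 0 to negative differences is the convention of `entry` for a negative number
  -- of arguments; it makes the matrices triangular.
  at-difference : (ℕ → Carrier) → ℕ → ℕ → Carrier
  at-difference f m       zero    = f m
  at-difference f zero    (suc n) = 0#
  at-difference f (suc m) (suc n) = at-difference f m n

  at-difference-< : ∀ f {m n} → m < n → at-difference f m n ≡ 0#
  at-difference-< f {zero}  (s≤s m<n) = ≡.refl
  at-difference-< f {suc m} (s≤s m<n) = at-difference-< f m<n

  at-difference-refl : ∀ f m → at-difference f m m ≡ f 0
  at-difference-refl f zero    = ≡.refl
  at-difference-refl f (suc m) = at-difference-refl f m

  at-difference-+ : ∀ {f g h} → (∀ d → h d ≈ f d + g d) → ∀ m n →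
                    at-difference h m n ≈ at-difference f m n + at-difference g m n
  at-difference-+ h≈ m       zero    = h≈ m
  at-difference-+ h≈ zero    (suc n) = sym (+-identityʳ 0#)
  at-difference-+ h≈ (suc m) (suc n) = at-difference-+ h≈ m n

  -- Here `x` is the weight of the last argument, and removing that argument raises `n`. As
  -- `at-difference f (suc m) (suc n)` reduces to `at-difference f m n`, the lemma serves equally
  -- where `m` falls instead. For `m ≤ n` both sides vanish.
  endingAt-recurrence : ∀ t y N x m n → (∀ d → m ≡ n ℕ.+ suc d → y N d ≈ x) →
    at-difference (endingAt t y N) m n ≈
    x * (at-difference (upTo t y N) m (suc n) + t * at-difference (endingAt t y N) m (suc n))
  endingAt-recurrence t y N x zero    zero    y≈x = solve 2 (λ x t → con (+ 0) := x :* (con (+ 0) :+ t :* con (+ 0))) refl x t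
  endingAt-recurrence t y N x (suc d) zero    y≈x = *-congʳ (y≈x d ≡.refl)
  endingAt-recurrence t y N x zero    (suc n) y≈x = solve 2 (λ x t → con (+ 0) := x :* (con (+ 0) :+ t :* con (+ 0))) refl x t
  endingAt-recurrence t y N x (suc m) (suc n) y≈x = endingAt-recurrence t y N x m n (λ d eq → y≈x d (≡.cong suc eq))

  alternating-sum-cong : ∀ {x x′ : ℕ → Carrier} o n → (∀ k → x k ≈ x′ k) → alternating-sum x o n ≈ alternating-sum x′ o n
  alternating-sum-cong o zero    x≈x′ = refl
  alternating-sum-cong o (suc n) x≈x′ = +-cong (x≈x′ o) (-‿cong (alternating-sum-cong (suc o) n x≈x′))

  alternating-sum-+ : ∀ x x′ o n → alternating-sum (λ k → x k + x′ k) o n ≈ alternating-sum x o n + alternating-sum x′ o n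
  alternating-sum-+ x x′ o zero    = sym (+-identityˡ 0#)
  alternating-sum-+ x x′ o (suc n) = trans (+-congˡ (-‿cong (alternating-sum-+ x x′ (suc o) n)))
    (solve 4 (λ p q r s → (p :+ q) :- (r :+ s) := (p :- r) :+ (q :- s)) refl _ _ _ _)

  alternating-sum-zero : ∀ x o n → (∀ {k} → o ℕ.≤ k → x k ≈ 0#) → alternating-sum x o n ≈ 0#
  alternating-sum-zero x o zero    x≈0 = refl
  alternating-sum-zero x o (suc n) x≈0 = trans
    (+-cong (x≈0 ℕ.≤-refl) (-‿cong (alternating-sum-zero x (suc o) n (x≈0 ∘ ℕ.<⇒≤))))
    (solve 0 (con (+ 0) :- con (+ 0) := con (+ 0)) refl)

  alternating-sum-single : ∀ x o {n} d → d < n → (∀ {k} → ¬ (k ≡ o ℕ.+ d) → x k ≈ 0#) →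
                           alternating-sum x o n ≈ ((- 1#) ^ d) * x (o ℕ.+ d)
  alternating-sum-single x o {suc n} zero    d<n x≈0 rewrite ℕ.+-identityʳ o = trans
    (+-congˡ (-‿cong (alternating-sum-zero x (suc o) n (λ o<k → x≈0 (ℕ.>⇒≢ o<k)))))
    (solve 1 (λ x → x :- con (+ 0) := con (+ 1) :* x) refl (x o))
  alternating-sum-single x o {suc n} (suc d) (s≤s d<n) x≈0 rewrite ℕ.+-suc o d = trans
    (+-cong (x≈0 (ℕ.<⇒≢ (s≤s (ℕ.m≤m+n o d)))) (-‿cong (alternating-sum-single x (suc o) d d<n x≈0)))
    (solve 2 (λ p x → con (+ 0) :- p :* x := (:- con (+ 1) :* p) :* x) refl _ _)

  -- `B k` and `A (suc k)` enter with opposite signs, so only the two ends survive.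
  alternating-sum-telescope : ∀ (A B : ℕ → Carrier) o n → (∀ k → A (suc k) ≈ B k) → A (o ℕ.+ n) ≈ 0# →
                              alternating-sum (λ k → A k + B k) o n ≈ A o
  alternating-sum-telescope A B o zero    step last≈0 rewrite ℕ.+-identityʳ o = sym last≈0
  alternating-sum-telescope A B o (suc n) step last≈0 rewrite ℕ.+-suc o n = begin
    (A o + B o) - alternating-sum (λ k → A k + B k) (suc o) n
      ≈⟨ +-congˡ (-‿cong (trans (alternating-sum-telescope A B (suc o) n step last≈0) (step o))) ⟩
    (A o + B o) - B o   ≈⟨ solve 2 (λ a b → (a :+ b) :- b := a) refl (A o) (B o) ⟩
    A o                 ∎

  -- The generating function of the sums over a single value m of all mᵢ is
  -- (1 + (1 - t)X)/(1 - tX), whose inverse is obtained by X ↦ -X, t ↦ 1 - t.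
  -- So duality holds for every truncation, by induction on N.
  module Duality (t t′ : Carrier) (t+t′≈1 : t + t′ ≈ 1#) (x : ℕ → ℕ → Carrier)
    (y y′ : ℕ → ℕ → ℕ → Carrier)
    (y≈x  : ∀ j N d {k} → k ≡ j ℕ.+ d → y j N d ≈ x N k)
    (y′≈x : ∀ i N d {k} → i ≡ k ℕ.+ suc d → y′ i N d ≈ x N k)
    where

    -- `u N i k` runs through the weights at i - 1, ..., k and `e N j k` through those at j, ..., k
    -- - 1. Both runs end next to `k`, so moving `k` by one adds or removes a last factor.
    u : ℕ → ℕ → ℕ → Carrier
    u N i k = at-difference (upTo t′ (y′ i) N) i k

    e : ℕ → ℕ → ℕ → Carrier
    e N j k = at-difference (upTo t (y j) N) k j

    u-diagonal : ∀ N i → u N i i ≈ 1#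
    u-diagonal N i = reflexive (at-difference-refl (upTo t′ (y′ i) N) i)

    u-triangular : ∀ N {i k} → i < k → u N i k ≈ 0#
    u-triangular N {i} i<k = reflexive (at-difference-< (upTo t′ (y′ i) N) i<k)

    pairing : ℕ → ℕ → ℕ → ℕ → Carrier
    pairing N n i j = alternating-sum (λ k → u N i k * e N j k) 0 n

    -- The new terms involve the value N + 1 on at least one side. They cancel in pairs: the weight
    -- `x N k` that ends the run of `e` at `suc k` can be handed over to the run of `u` at `k`, and
    -- these two terms carry opposite signs.
    pairing-suc : ∀ N {n i} j → i < n → pairing (suc N) n i j ≈ pairing N n i j
    pairing-suc N {n} {i} j i<n = begin
      alternating-sum (λ k → u (suc N) i k * e (suc N) j k) 0 n
        ≈⟨ alternating-sum-cong 0 n expand ⟩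
      alternating-sum (λ k → u N i k * e N j k + (A k + B k)) 0 n
        ≈⟨ alternating-sum-+ _ _ 0 n ⟩
      pairing N n i j + alternating-sum (λ k → A k + B k) 0 n
        ≈⟨ +-congˡ (trans (alternating-sum-telescope A B 0 n step last≈0) first≈0) ⟩
      pairing N n i j + 0#
        ≈⟨ +-identityʳ _ ⟩
      pairing N n i j ∎
      where
      p q τ σ : ℕ → Carrier
      p = e N j
      q = u N i
      τ k = at-difference (endingAt t (y j) N) k j
      σ k = at-difference (endingAt t′ (y′ i) N) i k

      A B : ℕ → Carrier
      A k = τ k * (q k + t′ * σ k)
      B k = (p k + t * τ k) * σ k

      expand : ∀ k → u (suc N) i k * e (suc N) j k ≈ u N i k * e N j k + (A k + B k)
      expand k = begin
        u (suc N) i k * e (suc N) j k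
          ≈⟨ *-cong (at-difference-+ (upTo-suc t′ (y′ i) N) i k) (at-difference-+ (upTo-suc t (y j) N) k j) ⟩
        (q k + σ k) * (p k + τ k)
          ≈⟨ solve 4 (λ q s p r → (q :+ s) :* (p :+ r) := q :* p :+ (r :* q :+ p :* s :+ con (+ 1) :* (r :* s))) refl
               (q k) (σ k) (p k) (τ k) ⟩
        -- The terms with N + 1 on both sides are shared out between `A` and `B` in the proportions
        -- t′ and t. This is the point at which t + t′ = 1 enters.
        q k * p k + (τ k * q k + p k * σ k + 1# * (τ k * σ k))
          ≈⟨ +-congˡ (+-congˡ (*-congʳ t+t′≈1)) ⟨
        q k * p k + (τ k * q k + p k * σ k + (t + t′) * (τ k * σ k))
          ≈⟨ solve 6 (λ q s p r t t′ → q :* p :+ (r :* q :+ p :* s :+ (t :+ t′) :* (r :* s)) :=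
                                        q :* p :+ (r :* (q :+ t′ :* s) :+ (p :+ t :* r) :* s)) refl
               (q k) (σ k) (p k) (τ k) t t′ ⟩
        q k * p k + (A k + B k) ∎

      τ-suc : ∀ k → τ (suc k) ≈ x N k * (p k + t * τ k)
      τ-suc k = endingAt-recurrence t (y j) N (x N k) (suc k) j
        (λ d eq → y≈x j N d (ℕ.suc-injective (≡.trans eq (ℕ.+-suc j d))))

      σ-suc : ∀ k → σ k ≈ x N k * (q (suc k) + t′ * σ (suc k))
      σ-suc k = endingAt-recurrence t′ (y′ i) N (x N k) i k (λ d eq → y′≈x i N d eq)

      step : ∀ k → A (suc k) ≈ B k
      step k = begin
        τ (suc k) * (q (suc k) + t′ * σ (suc k))
          ≈⟨ *-congʳ (τ-suc k) ⟩
        (x N k * (p k + t * τ k)) * (q (suc k) + t′ * σ (suc k))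
          ≈⟨ solve 3 (λ x a b → (x :* a) :* b := a :* (x :* b)) refl (x N k) _ _ ⟩
        (p k + t * τ k) * (x N k * (q (suc k) + t′ * σ (suc k)))
          ≈⟨ *-congˡ (σ-suc k) ⟨
        (p k + t * τ k) * σ k ∎

      first≈0 : A 0 ≈ 0#
      first≈0 = trans (*-congʳ (τ₀ j)) (zeroˡ _)
        where
        τ₀ : ∀ j → at-difference (endingAt t (y j) N) 0 j ≈ 0#
        τ₀ zero    = refl
        τ₀ (suc j) = refl

      last≈0 : A n ≈ 0#
      last≈0 = trans (*-congˡ (+-cong (reflexive (at-difference-< (upTo t′ (y′ i) N) i<n))
                                      (*-congˡ (reflexive (at-difference-< (endingAt t′ (y′ i) N) i<n)))))
        (solve 2 (λ r t → r :* (con (+ 0) :+ t :* con (+ 0)) := con (+ 0)) refl (τ n) t′)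

    at-difference-upTo-zero : ∀ t y {m n} → ¬ (m ≡ n) → at-difference (upTo t y 0) m n ≈ 0#
    at-difference-upTo-zero t y {zero}  {zero}  m≢n = contradiction ≡.refl m≢n
    at-difference-upTo-zero t y {suc m} {zero}  m≢n = refl
    at-difference-upTo-zero t y {zero}  {suc n} m≢n = refl
    at-difference-upTo-zero t y {suc m} {suc n} m≢n = at-difference-upTo-zero t y (m≢n ∘ ≡.cong suc)

    -- Without any value to sum over only empty runs remain, so `u 0` is the identity matrix and
    -- only k = i contributes.
    pairing-zero : ∀ {n i} j → i < n → pairing 0 n i j ≈ ((- 1#) ^ i) * e 0 j i
    pairing-zero {n} {i} j i<n = trans
      (alternating-sum-single _ 0 i i<n
        (λ k≢i → trans (*-congʳ (at-difference-upTo-zero t′ (y′ i) (λ i≡k → k≢i (≡.sym i≡k)))) (zeroˡ _)))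
      (*-congˡ (trans (*-congʳ (u-diagonal 0 i)) (*-identityˡ _)))

    pairing-e : ∀ N {n i} j → i < n → pairing N n i j ≈ ((- 1#) ^ i) * e 0 j i
    pairing-e zero    j i<n = pairing-zero j i<n
    pairing-e (suc N) j i<n = trans (pairing-suc N j i<n) (pairing-e N j i<n)

    pairing-self : ∀ N {n} j → j < n → pairing N n j j ≈ (- 1#) ^ j
    pairing-self N j j<n = trans (pairing-e N j j<n)
      (trans (*-congˡ (reflexive (at-difference-refl (upTo t (y j) 0) j))) (*-identityʳ _))

    pairing-orthogonal : ∀ N {n i j} → j < i → i < n → pairing N n i j ≈ 0#
    pairing-orthogonal N {j = j} j<i i<n = trans (pairing-e N j i<n)
      (trans (*-congˡ (at-difference-upTo-zero t (y j) (ℕ.>⇒≢ j<i))) (zeroʳ _))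

-- The boundary of a Young diagram and its steps.

enumerates-cong : ∀ {n k o} {b : Vec Bool n} {s s′ : Fin k → ℕ} →
                  Enumerates o b s → (∀ i → s i ≡ s′ i) → Enumerates o b s′
enumerates-cong []            s≡s′ = []
enumerates-cong (skip p)      s≡s′ = skip (enumerates-cong p s≡s′)
enumerates-cong (take s₀≡o p) s≡s′ = take (≡.trans (≡.sym (s≡s′ zero)) s₀≡o) (enumerates-cong p (s≡s′ ∘ suc))

enumerates-∷ʳ-false : ∀ {n k o} {b : Vec Bool n} {s : Fin k → ℕ} →
                      Enumerates o b s → Enumerates o (b ∷ʳ false) s
enumerates-∷ʳ-false []            = skip []
enumerates-∷ʳ-false (skip p)      = skip (enumerates-∷ʳ-false p)
enumerates-∷ʳ-false (take s₀≡o p) = take s₀≡o (enumerates-∷ʳ-false p)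

enumerates-∷ʳ-true : ∀ {n k o} {b : Vec Bool n} {s′ : Fin k → ℕ} (s : Fin (suc k) → ℕ) →
  Enumerates o b s′ → (∀ i → s′ i ≡ s (inject₁ i)) → s (fromℕ k) ≡ o ℕ.+ n → Enumerates o (b ∷ʳ true) s
enumerates-∷ʳ-true {o = o} s [] s′≡s last≡ = take (≡.trans last≡ (ℕ.+-identityʳ o)) []
enumerates-∷ʳ-true {suc n} {o = o} s (skip p) s′≡s last≡ =
  skip (enumerates-∷ʳ-true s p s′≡s (≡.trans last≡ (ℕ.+-suc o n)))
enumerates-∷ʳ-true {suc n} {o = o} s (take s₀≡o p) s′≡s last≡ = take (≡.trans (≡.sym (s′≡s zero)) s₀≡o)
  (enumerates-∷ʳ-true (s ∘ suc) p (s′≡s ∘ suc) (≡.trans last≡ (ℕ.+-suc o n)))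

conjugate-part : ∀ {h} → Vec ℕ h → ℕ → ℕ
conjugate-part p j = count (suc j ℕ.≤?_) p

lookup-≤ : ∀ {h W} {p : Vec ℕ h} → Linked ℕ._≥_ (W ∷ p) → ∀ i → lookup p i ≤ W
lookup-≤ {p = _ ∷ _} (W≥x ∷ l) zero    = W≥x
lookup-≤ {p = _ ∷ _} (W≥x ∷ l) (suc i) = ℕ.≤-trans (lookup-≤ l i) W≥x

conjugate-part-zero : ∀ {h W W′} {p : Vec ℕ h} → W ≤ W′ → Linked ℕ._≥_ (W ∷ p) → conjugate-part p W′ ≡ 0
conjugate-part-zero W≤W′ [-] = ≡.refl
conjugate-part-zero {W′ = W′} {x ∷ p} W≤W′ (W≥x ∷ l)
  rewrite dec-false (suc W′ ℕ.≤? x) (ℕ.≤⇒≯ (ℕ.≤-trans W≥x W≤W′)) = conjugate-part-zero (ℕ.≤-trans W≥x W≤W′) l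

conjugate-part-∷ : ∀ {h x j} (p : Vec ℕ h) → j < x → conjugate-part (x ∷ p) j ≡ suc (conjugate-part p j)
conjugate-part-∷ {x = x} {j} p j<x rewrite dec-true (suc j ℕ.≤? x) j<x = ≡.refl

-- The boundary of the Young diagram inside W columns, from its upper right to
-- its lower left end: true is a vertical step, false a horizontal one.
record BoundaryWord (W : ℕ) {h : ℕ} (p : Vec ℕ h) : Set where
  constructor boundaryWord
  field
    {length} : ℕ
    word     : Vec Bool length
    length≡  : length ≡ W ℕ.+ h
    rows     : ∀ o → Enumerates o word λ (i : Fin h) → o ℕ.+ (W ℕ.∸ lookup p i) ℕ.+ toℕ i
    columns  : Enumerates 0 (reverse (map not word)) λ (j : Fin W) → h ℕ.∸ conjugate-part p (toℕ j) ℕ.+ toℕ j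

-- The new column is empty. Its horizontal step comes first in the word and shifts all rows by one;
-- read from the other end it comes last, at W + h, the position of a column with conjugate part 0.
extend-column : ∀ {W h} {p : Vec ℕ h} → Linked ℕ._≥_ (W ∷ p) → BoundaryWord W p → BoundaryWord (suc W) p
extend-column {W} {h} {p} l (boundaryWord {n} b n≡ rows columns) = boundaryWord (false ∷ b) (≡.cong suc n≡)
  (λ o → skip (enumerates-cong (rows (suc o)) λ i → ≡.cong (ℕ._+ toℕ i) (begin
    suc o ℕ.+ (W ℕ.∸ lookup p i)      ≡⟨ ℕ.+-suc o (W ℕ.∸ lookup p i) ⟨
    o ℕ.+ suc (W ℕ.∸ lookup p i)      ≡⟨ ≡.cong (o ℕ.+_) (ℕ.+-∸-assoc 1 (lookup-≤ l i)) ⟨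
    o ℕ.+ (suc W ℕ.∸ lookup p i)      ∎)))
  (≡.subst (λ b → Enumerates 0 b r) (≡.sym (Vec.reverse-∷ true (map not b)))
    (enumerates-∷ʳ-true r columns
      (λ i → ≡.cong (λ j → h ℕ.∸ conjugate-part p j ℕ.+ j) (≡.sym (Fin.toℕ-inject₁ i)))
      (begin
        h ℕ.∸ conjugate-part p (toℕ (fromℕ W)) ℕ.+ toℕ (fromℕ W)  ≡⟨ ≡.cong (λ j → h ℕ.∸ conjugate-part p j ℕ.+ j) (Fin.toℕ-fromℕ W) ⟩
        h ℕ.∸ conjugate-part p W ℕ.+ W                            ≡⟨ ≡.cong (λ c → h ℕ.∸ c ℕ.+ W) (conjugate-part-zero ℕ.≤-refl l) ⟩
        h ℕ.+ W                                                 ≡⟨ ℕ.+-comm h W ⟩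
        W ℕ.+ h                                                 ≡⟨ n≡ ⟨
        n                                                     ∎)))
  where
  open ≡-Reasoning
  r : Fin (suc W) → ℕ
  r j = h ℕ.∸ conjugate-part p (toℕ j) ℕ.+ toℕ j

-- The new row meets all `W` columns, so the height and every conjugate part grow by one and the
-- column positions stay as they are.
extend-row : ∀ {W h} {p : Vec ℕ h} → BoundaryWord W p → BoundaryWord W (W ∷ p)
extend-row {W} {h} {p} (boundaryWord b n≡ rows columns) = boundaryWord (true ∷ b)
  (≡.trans (≡.cong suc n≡) (≡.sym (ℕ.+-suc W h)))
  (λ o → take (≡.trans (ℕ.+-identityʳ _) (≡.trans (≡.cong (o ℕ.+_) (ℕ.n∸n≡0 W)) (ℕ.+-identityʳ o)))
    (enumerates-cong (rows (suc o)) λ i → ≡.sym (ℕ.+-suc (o ℕ.+ (W ℕ.∸ lookup p i)) (toℕ i))))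
  (≡.subst (λ b → Enumerates 0 b _) (≡.sym (Vec.reverse-∷ false (map not b)))
    (enumerates-∷ʳ-false (enumerates-cong columns λ j →
      ≡.cong (λ c → suc h ℕ.∸ c ℕ.+ toℕ j) (≡.sym (conjugate-part-∷ p (Fin.toℕ<n j))))))

-- `W` is only an upper bound for the parts, so that the induction can strip empty columns. A first
-- part equal to `W` gives a vertical step, a smaller one a horizontal step.
boundary-word : ∀ W {h} (p : Vec ℕ h) → Linked ℕ._≥_ (W ∷ p) → BoundaryWord W p
boundary-word zero    []      l = boundaryWord [] ≡.refl (λ _ → []) []
boundary-word (suc W) []      l = extend-column [-] (boundary-word W [] [-])
boundary-word W       (x ∷ p) (W≥x ∷ l) = by-cases W (ℕ.m≤n⇒m<n∨m≡n W≥x)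
  where
  by-cases : ∀ W → x < W ⊎ x ≡ W → BoundaryWord W (x ∷ p)
  by-cases W       (inj₂ ≡.refl)       = extend-row (boundary-word W p l)
  by-cases (suc W) (inj₁ (s≤s x≤W)) = extend-column (x≤W ∷ l) (by-cases W (ℕ.m≤n⇒m<n∨m≡n x≤W))

width-linked : (μ : Partition) → Linked ℕ._≥_ (Partition.width μ ∷ Partition.parts μ)
width-linked record { parts = [] }                           = [-]
width-linked record { parts = _ ∷ _ ; decreasing = decreasing } = ℕ.≤-refl ∷ decreasing

-- Transport of determinants and polynomials along homomorphisms.

module _ {c ℓ c′ ℓ′ : Level} (A : RawRing c ℓ) (B : RawRing c′ ℓ′) where
  private
    module A = RawRing A
    module B = RawRing B
    module PA = Polynomial A
    module PB = Polynomial B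

  -- Taking the N-th term of a representative does not respect `_≈ℝ_`. It does commute with the raw
  -- operations up to `_≡_`, and determinants are built from these alone.
  record StrictHomomorphism (φ : A.Carrier → B.Carrier) : Set (c ⊔ c′) where
    field
      +-hom : ∀ x y → φ (x A.+ y) ≡ φ x B.+ φ y
      *-hom : ∀ x y → φ (x A.* y) ≡ φ x B.* φ y
      neg-hom : ∀ x → φ (A.- x) ≡ B.- φ x
      0-hom : φ A.0# ≡ B.0#
      1-hom : φ A.1# ≡ B.1#

  module _ {φ : A.Carrier → B.Carrier} (φ-hom : StrictHomomorphism φ) where
    open StrictHomomorphism φ-hom

    det-hom : ∀ {n} (M : Fin n → Fin n → A.Carrier) →
              φ (Determinant.det A M) ≡ Determinant.det B (λ i j → φ (M i j))
    det-hom {zero}  M = 1-hom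
    det-hom {suc n} M = sum-hom _ _ λ j → ≡.trans (*-hom _ _)
      (≡.cong₂ B._*_ (power-hom (toℕ j)) (≡.trans (*-hom _ _) (≡.cong (φ (M zero j) B.*_) (det-hom λ i k → M (suc i) (punchIn j k)))))
      where
      open RawMonoidDefinitions A.+-rawMonoid using () renaming (sum to sumᴬ)
      open RawMonoidDefinitions B.+-rawMonoid using () renaming (sum to sumᴮ)
      open RawSemiringDefinitions A.rawSemiring using () renaming (_^_ to _^ᴬ_)
      open RawSemiringDefinitions B.rawSemiring using () renaming (_^_ to _^ᴮ_)

      sum-hom : ∀ {n} (f : Fin n → A.Carrier) (g : Fin n → B.Carrier) → (∀ j → φ (f j) ≡ g j) → φ (sumᴬ f) ≡ sumᴮ g
      sum-hom {zero}  f g φf≡g = 0-hom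
      sum-hom {suc n} f g φf≡g = ≡.trans (+-hom _ _) (≡.cong₂ B._+_ (φf≡g zero) (sum-hom (f ∘ suc) (g ∘ suc) (φf≡g ∘ suc)))

      power-hom : ∀ j → φ ((A.- A.1#) ^ᴬ j) ≡ (B.- B.1#) ^ᴮ j
      power-hom zero    = 1-hom
      power-hom (suc j) = ≡.trans (*-hom _ _)
        (≡.cong₂ B._*_ (≡.trans (neg-hom A.1#) (≡.cong B.-_ 1-hom)) (power-hom j))

    map-add : ∀ p q → List.map φ (PA.add p q) ≡ PB.add (List.map φ p) (List.map φ q)
    map-add []      q       = ≡.refl
    map-add (a ∷ p) []      = ≡.refl
    map-add (a ∷ p) (b ∷ q) = ≡.cong₂ _∷_ (+-hom a b) (map-add p q)

    map-mul : ∀ p q → List.map φ (PA.mul p q) ≡ PB.mul (List.map φ p) (List.map φ q)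
    map-mul []      q = ≡.refl
    map-mul (a ∷ p) q = ≡.trans (map-add (List.map (a A.*_) q) (A.0# ∷ PA.mul p q))
      (≡.cong₂ PB.add
        (≡.trans (≡.sym (List.map-∘ q)) (≡.trans (List.map-cong (*-hom a) q) (List.map-∘ q)))
        (≡.cong₂ _∷_ 0-hom (map-mul p q)))

    map-compose : ∀ p q → List.map φ (PA.compose p q) ≡ PB.compose (List.map φ p) (List.map φ q)
    map-compose []      q = ≡.refl
    map-compose (a ∷ p) q = ≡.trans (map-add (a ∷ []) (PA.mul q (PA.compose p q)))
      (≡.cong (PB.add (φ a ∷ [])) (≡.trans (map-mul q (PA.compose p q)) (≡.cong (PB.mul (List.map φ q)) (map-compose p q))))

    map-neg : ∀ p → List.map φ (List.map A.-_ p) ≡ List.map B.-_ (List.map φ p)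
    map-neg p = ≡.trans (≡.sym (List.map-∘ p)) (≡.trans (List.map-cong neg-hom p) (List.map-∘ p))

    coeff-hom : ∀ p n → φ (PA.coeff p n) ≡ PB.coeff (List.map φ p) n
    coeff-hom []      n       = 0-hom
    coeff-hom (a ∷ p) zero    = ≡.refl
    coeff-hom (a ∷ p) (suc n) = coeff-hom p n

-- Truncated zeta values as polynomials over the rationals.

open PolynomialRing ℚ.+-*-commutativeRing
open TruncatedSums commutativeRing
open ExteriorAlgebra commutativeRing using (countdown; complementary-minors)
open Determinant ℙ.rawRing using () renaming (det to detᴾ)

module TruncatedZeta where
  open IntegerCoefficients commutativeRing using (module Solver)
  open Solver using (solve; _:=_; _:+_; _:*_; con)

  monomial : ℚ → ℕ → Poly
  monomial c zero    = constant c
  monomial c (suc j) = 0ℚ ∷ monomial c j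

  coeff-monomial-≡ : ∀ c j → coeff (monomial c j) j ≡ c
  coeff-monomial-≡ c zero    = ≡.refl
  coeff-monomial-≡ c (suc j) = coeff-monomial-≡ c j

  coeff-monomial-≢ : ∀ c {i j} → ¬ (i ≡ j) → coeff (monomial c i) j ≡ 0ℚ
  coeff-monomial-≢ c {zero}  {zero}  i≢j = contradiction ≡.refl i≢j
  coeff-monomial-≢ c {zero}  {suc j} i≢j = ≡.refl
  coeff-monomial-≢ c {suc i} {zero}  i≢j = ≡.refl
  coeff-monomial-≢ c {suc i} {suc j} i≢j = coeff-monomial-≢ c (i≢j ∘ ≡.cong suc)

  monomial-constant-* : ∀ c x j → monomial (c ℚ.* x) j ℙ.≈ constant x ℙ.* monomial c j
  monomial-constant-* c x zero    = ℙ.trans (constant-* c x) (ℙ.*-comm (constant c) (constant x))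
  monomial-constant-* c x (suc j) = begin
    0ℚ ∷ monomial (c ℚ.* x) j                            ≈⟨ shift (monomial (c ℚ.* x) j) ⟨
    indeterminate ℙ.* monomial (c ℚ.* x) j               ≈⟨ ℙ.*-congˡ {indeterminate} (monomial-constant-* c x j) ⟩
    indeterminate ℙ.* (constant x ℙ.* monomial c j)
      ≈⟨ solve 3 (λ t x m → t :* (x :* m) := x :* (t :* m)) ℙ.refl indeterminate (constant x) (monomial c j) ⟩
    constant x ℙ.* (indeterminate ℙ.* monomial c j)      ≈⟨ ℙ.*-congˡ {constant x} (shift (monomial c j)) ⟩
    constant x ℙ.* (0ℚ ∷ monomial c j)                   ∎
    where open SetoidReasoning ℙ.setoid

  -- `ζ-partial` filters the tuples separately for each degree. Here they stay together, each with
  -- its power of t, so that the recursion of `weaklyIncreasing` can be followed.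
  generating : ∀ {r} → Vec ℕ (suc r) → List (Vec ℕ (suc r)) → Poly
  generating k []       = []
  generating k (m ∷ ms) = monomial (summand k m) (equalities m) ℙ.+ generating k ms

  coeff-generating : ∀ {r} (k : Vec ℕ (suc r)) j ms →
    coeff (generating k ms) j ≡ sumℚ (List.map (summand k) (List.filter (λ m → equalities m ℕ.≟ j) ms))
  coeff-generating k j []       = ≡.refl
  coeff-generating k j (m ∷ ms) = ≡.trans
    (coeff-add (monomial (summand k m) (equalities m)) (generating k ms) j)
    (by-degree (equalities m ℕ.≟ j))
    where
    rest = sumℚ (List.map (summand k) (List.filter (λ m → equalities m ℕ.≟ j) ms))

    by-degree : Dec (equalities m ≡ j) →
      coeff (monomial (summand k m) (equalities m)) j ℚ.+ coeff (generating k ms) j ≡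
      sumℚ (List.map (summand k) (List.filter (λ m → equalities m ℕ.≟ j) (m ∷ ms)))
    by-degree (yes e≡j) = ≡.trans
      (≡.cong₂ ℚ._+_ (≡.subst (λ i → coeff (monomial (summand k m) i) j ≡ summand k m) (≡.sym e≡j) (coeff-monomial-≡ _ j))
                     (coeff-generating k j ms))
      (≡.cong (sumℚ ∘ List.map (summand k)) (≡.sym (List.filter-accept (λ m → equalities m ℕ.≟ j) e≡j)))
    by-degree (no e≢j)  = ≡.trans
      (≡.cong₂ ℚ._+_ (coeff-monomial-≢ (summand k m) e≢j) (coeff-generating k j ms))
      (≡.trans (ℚ.+-identityˡ rest)
        (≡.cong (sumℚ ∘ List.map (summand k)) (≡.sym (List.filter-reject (λ m → equalities m ℕ.≟ j) e≢j))))

  coeff-tabulate-< : ∀ n (f : ℕ → ℚ) {j} → j < n → coeff (List.tabulate {n = n} (f ∘ toℕ)) j ≡ f j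
  coeff-tabulate-< (suc n) f {zero}  j<n       = ≡.refl
  coeff-tabulate-< (suc n) f {suc j} (s≤s j<n) = coeff-tabulate-< n (f ∘ suc) j<n

  coeff-tabulate-≥ : ∀ n (f : ℕ → ℚ) {j} → n ≤ j → coeff (List.tabulate {n = n} (f ∘ toℕ)) j ≡ 0ℚ
  coeff-tabulate-≥ zero    f         n≤j       = ≡.refl
  coeff-tabulate-≥ (suc n) f {suc j} (s≤s n≤j) = coeff-tabulate-≥ n (f ∘ suc) n≤j

  truncated-ζ : ∀ {r} → Vec ℕ (suc r) → ℕ → Poly
  truncated-ζ {r} k N = List.tabulate λ (j : Fin (suc r)) → ζ-partial k (toℕ j) N

  truncated-ζ-generating : ∀ {r} (k : Vec ℕ (suc r)) N →
    truncated-ζ k N ℙ.≈ generating k (weaklyIncreasing N (suc r))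
  truncated-ζ-generating {r} k N = coefficientwise λ j → by-degree j (ℕ.<-≤-connex j (suc r))
    where
    ms = weaklyIncreasing N (suc r)

    vanishing : ∀ {j} → suc r ≤ j → ∀ ms → List.filter (λ m → equalities m ℕ.≟ j) ms ≡ []
    vanishing {j} r<j ms = List.filter-none (λ m → equalities m ℕ.≟ j)
      (ListAll.universal (λ m → ℕ.<⇒≢ (ℕ.≤-trans (s≤s (Vec.count≤n _ (Vec.zip (Vec.init m) (Vec.tail m)))) r<j)) ms)

    by-degree : ∀ j → j < suc r ⊎ suc r ≤ j → coeff (truncated-ζ k N) j ≡ coeff (generating k ms) j
    by-degree j (inj₁ j≤r) = ≡.trans (coeff-tabulate-< (suc r) (λ j → ζ-partial k j N) j≤r) (≡.sym (coeff-generating k j ms))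
    by-degree j (inj₂ r<j) = ≡.trans (coeff-tabulate-≥ (suc r) (λ j → ζ-partial k j N) r<j)
      (≡.trans (≡.cong (sumℚ ∘ List.map (summand k)) (≡.sym (vanishing r<j ms))) (≡.sym (coeff-generating k j ms)))

  generating-++ : ∀ {r} (k : Vec ℕ (suc r)) ms ms′ →
                  generating k (ms ++ ms′) ℙ.≈ generating k ms ℙ.+ generating k ms′
  generating-++ k []       ms′ = ℙ.refl
  generating-++ k (m ∷ ms) ms′ = ℙ.trans
    (ℙ.+-congˡ {monomial (summand k m) (equalities m)} (generating-++ k ms ms′))
    (ℙ.sym (ℙ.+-assoc (monomial (summand k m) (equalities m)) (generating k ms) (generating k ms′)))

  suc-if : Bool → ℕ → ℕ
  suc-if b = if b then suc else id

  suc-if-suc : ∀ b n → suc-if b (suc n) ≡ suc (suc-if b n)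
  suc-if-suc true  n = ≡.refl
  suc-if-suc false n = ≡.refl

  equalities-∷ʳ-≡ : ∀ {r} (m : Vec ℕ r) x → equalities ((m ∷ʳ x) ∷ʳ x) ≡ suc (equalities (m ∷ʳ x))
  equalities-∷ʳ-≡ []          x rewrite dec-true (x ℕ.≟ x) ≡.refl = ≡.refl
  equalities-∷ʳ-≡ (z ∷ [])    x = ≡.trans
    (≡.cong (suc-if (does (z ℕ.≟ x))) (equalities-∷ʳ-≡ [] x)) (suc-if-suc (does (z ℕ.≟ x)) _)
  equalities-∷ʳ-≡ (z ∷ w ∷ m) x = ≡.trans
    (≡.cong (suc-if (does (z ℕ.≟ w))) (equalities-∷ʳ-≡ (w ∷ m) x)) (suc-if-suc (does (z ℕ.≟ w)) _)

  equalities-∷ʳ-≢ : ∀ {r} (m : Vec ℕ r) {x y} → ¬ (x ≡ y) → equalities ((m ∷ʳ x) ∷ʳ y) ≡ equalities (m ∷ʳ x)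
  equalities-∷ʳ-≢ []          {x} {y} x≢y rewrite dec-false (x ℕ.≟ y) x≢y = ≡.refl
  equalities-∷ʳ-≢ (z ∷ [])    {x} x≢y = ≡.cong (suc-if (does (z ℕ.≟ x))) (equalities-∷ʳ-≢ [] x≢y)
  equalities-∷ʳ-≢ (z ∷ w ∷ m)     x≢y = ≡.cong (suc-if (does (z ℕ.≟ w))) (equalities-∷ʳ-≢ (w ∷ m) x≢y)

  -- The bound x ≤ N guarantees that appending `suc N` creates no new equality.
  weaklyIncreasing-last : ∀ N r →
    ListAll.All (λ m → ∃₂ λ m′ x → m ≡ m′ ∷ʳ x × x ≤ N) (weaklyIncreasing N (suc r))
  weaklyIncreasing-last zero    r = ListAll.[]
  weaklyIncreasing-last (suc N) r = ListAll.++⁺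
    (ListAll.map (λ { (m , x , eq , x≤N) → m , x , eq , ℕ.m≤n⇒m≤1+n x≤N }) (weaklyIncreasing-last N r))
    (ListAll.map⁺ (ListAll.universal (λ m → m , suc N , ≡.refl , ℕ.≤-refl) (weaklyIncreasing (suc N) r)))

  module _ {r : ℕ} (k : Vec ℕ (suc r)) (l n : ℕ) where
    private c = recip (n ℕ.^ l)

    generating-∷ʳ : ∀ {ms} → ListAll.All (λ m → equalities (m ∷ʳ n) ≡ equalities m) ms →
      generating (k ∷ʳ l) (List.map (_∷ʳ n) ms) ℙ.≈ constant c ℙ.* generating k ms
    generating-∷ʳ ListAll.[] = ℙ.sym (ℙ.zeroʳ (constant c))
    generating-∷ʳ {m ∷ ms} (eq ListAll.∷ eqs) = begin
      monomial (summand (k ∷ʳ l) (m ∷ʳ n)) (equalities (m ∷ʳ n)) ℙ.+ generating (k ∷ʳ l) (List.map (_∷ʳ n) ms)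
        ≡⟨ ≡.cong₂ (λ s e → monomial s e ℙ.+ generating (k ∷ʳ l) (List.map (_∷ʳ n) ms)) (summand-∷ʳ k m l n) eq ⟩
      monomial (summand k m ℚ.* c) (equalities m) ℙ.+ generating (k ∷ʳ l) (List.map (_∷ʳ n) ms)
        ≈⟨ ℙ.+-cong (monomial-constant-* (summand k m) c (equalities m)) (generating-∷ʳ eqs) ⟩
      constant c ℙ.* monomial (summand k m) (equalities m) ℙ.+ constant c ℙ.* generating k ms
        ≈⟨ ℙ.distribˡ (constant c) (monomial (summand k m) (equalities m)) (generating k ms) ⟨
      constant c ℙ.* (monomial (summand k m) (equalities m) ℙ.+ generating k ms) ∎
      where open SetoidReasoning ℙ.setoid

    generating-∷ʳ-repeated : ∀ {ms} → ListAll.All (λ m → equalities (m ∷ʳ n) ≡ suc (equalities m)) ms →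
      generating (k ∷ʳ l) (List.map (_∷ʳ n) ms) ℙ.≈ constant c ℙ.* (indeterminate ℙ.* generating k ms)
    generating-∷ʳ-repeated ListAll.[] = solve 2 (λ c t → con (+ 0) := c :* (t :* con (+ 0))) ℙ.refl (constant c) indeterminate
    generating-∷ʳ-repeated {m ∷ ms} (eq ListAll.∷ eqs) = begin
      monomial (summand (k ∷ʳ l) (m ∷ʳ n)) (equalities (m ∷ʳ n)) ℙ.+ generating (k ∷ʳ l) (List.map (_∷ʳ n) ms)
        ≡⟨ ≡.cong₂ (λ s e → monomial s e ℙ.+ generating (k ∷ʳ l) (List.map (_∷ʳ n) ms)) (summand-∷ʳ k m l n) eq ⟩
      monomial (summand k m ℚ.* c) (suc (equalities m)) ℙ.+ generating (k ∷ʳ l) (List.map (_∷ʳ n) ms)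
        ≈⟨ ℙ.+-cong (ℙ.trans (monomial-constant-* (summand k m) c (suc (equalities m)))
                             (ℙ.*-congˡ {constant c} (ℙ.sym (shift (monomial (summand k m) (equalities m))))))
                    (generating-∷ʳ-repeated eqs) ⟩
      constant c ℙ.* (indeterminate ℙ.* monomial (summand k m) (equalities m)) ℙ.+ constant c ℙ.* (indeterminate ℙ.* generating k ms)
        ≈⟨ solve 4 (λ c t m g → c :* (t :* m) :+ c :* (t :* g) := c :* (t :* (m :+ g))) ℙ.refl
             (constant c) indeterminate (monomial (summand k m) (equalities m)) (generating k ms) ⟩
      constant c ℙ.* (indeterminate ℙ.* (monomial (summand k m) (equalities m) ℙ.+ generating k ms)) ∎
      where open SetoidReasoning ℙ.setoid

  prefix : (ℕ → ℕ) → ∀ n → Vec ℕ n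
  prefix f n = Vec.tabulate (f ∘ toℕ)

  prefix-∷ʳ : ∀ f n → prefix f (suc n) ≡ prefix f n ∷ʳ f n
  prefix-∷ʳ f zero    = ≡.refl
  prefix-∷ʳ f (suc n) = ≡.cong (f 0 ∷_) (prefix-∷ʳ (f ∘ suc) n)

  weight : (ℕ → ℕ) → ℕ → ℕ → Poly
  weight f N d = constant (recip (suc N ℕ.^ f d))

  module _ (f : ℕ → ℕ) where
    private
      y = weight f

    -- Both sides split by the last entry. Removing a last entry N + 1 leaves either a tuple bounded
    -- by N or one that again ends in N + 1; the latter loses one equality, hence the factor t.
    generating-upTo : ∀ N d → generating (prefix f (suc d)) (weaklyIncreasing N (suc d)) ℙ.≈ upTo indeterminate y N (suc d)
    generating-endingAt : ∀ N d → generating (prefix f (suc d)) (List.map (_∷ʳ suc N) (weaklyIncreasing (suc N) d)) ℙ.≈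
                          endingAt indeterminate y N (suc d)

    generating-upTo zero    d = ℙ.refl
    generating-upTo (suc N) d = ℙ.trans
      (generating-++ (prefix f (suc d)) (weaklyIncreasing N (suc d)) _)
      (ℙ.+-cong (generating-upTo N d) (generating-endingAt N d))

    generating-endingAt N zero = ℙ.trans
      (ℙ.reflexive (≡.cong (λ x → constant (recip x)) (ℕ.*-identityʳ (suc N ℕ.^ f 0))))
      (solve 2 (λ y t → y := y :* (con (+ 1) :+ t :* con (+ 0))) ℙ.refl (y N 0) indeterminate)
    generating-endingAt N (suc d) = begin
      generating (prefix f (suc (suc d))) (List.map (_∷ʳ suc N) (old ++ new))
        ≡⟨ ≡.cong₂ generating (prefix-∷ʳ f (suc d)) (List.map-++ (_∷ʳ suc N) old new) ⟩
      generating (k ∷ʳ l) (List.map (_∷ʳ suc N) old ++ List.map (_∷ʳ suc N) new)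
        ≈⟨ generating-++ (k ∷ʳ l) (List.map (_∷ʳ suc N) old) (List.map (_∷ʳ suc N) new) ⟩
      generating (k ∷ʳ l) (List.map (_∷ʳ suc N) old) ℙ.+ generating (k ∷ʳ l) (List.map (_∷ʳ suc N) new)
        ≈⟨ ℙ.+-cong
             (generating-∷ʳ k l (suc N) (ListAll.map
               (λ { (m , x , ≡.refl , x≤N) → equalities-∷ʳ-≢ m (ℕ.<⇒≢ (s≤s x≤N)) }) (weaklyIncreasing-last N d)))
             (generating-∷ʳ-repeated k l (suc N) (ListAll.map⁺
               (ListAll.universal (λ m → equalities-∷ʳ-≡ m (suc N)) (weaklyIncreasing (suc N) d)))) ⟩
      y N (suc d) ℙ.* generating k old ℙ.+ y N (suc d) ℙ.* (indeterminate ℙ.* generating k new)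
        ≈⟨ ℙ.distribˡ (y N (suc d)) (generating k old) (indeterminate ℙ.* generating k new) ⟨
      y N (suc d) ℙ.* (generating k old ℙ.+ indeterminate ℙ.* generating k new)
        ≈⟨ ℙ.*-congˡ {y N (suc d)} (ℙ.+-cong (generating-upTo N d) (ℙ.*-congˡ {indeterminate} (generating-endingAt N d))) ⟩
      endingAt indeterminate y N (suc (suc d)) ∎
      where
      open SetoidReasoning ℙ.setoid
      k = prefix f (suc d)
      l = f (suc d)
      old = weaklyIncreasing N (suc d)
      new = List.map (_∷ʳ suc N) (weaklyIncreasing (suc N) d)

    truncated-ζ-upTo : ∀ N d → truncated-ζ (prefix f (suc d)) N ℙ.≈ upTo indeterminate y N (suc d)
    truncated-ζ-upTo N d = ℙ.trans (truncated-ζ-generating (prefix f (suc d)) N) (generating-upTo N d)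

    module _ (q : Poly) where
      open Substitution q

      subst-upTo : ∀ N d → compose (upTo indeterminate y N d) q ℙ.≈ upTo q y N d
      subst-endingAt : ∀ N d → compose (endingAt indeterminate y N d) q ℙ.≈ endingAt q y N d

      subst-upTo N       zero    = subst-one
      subst-upTo zero    (suc d) = ℙ.refl
      subst-upTo (suc N) (suc d) = ℙ.trans
        (subst-+ (upTo indeterminate y N (suc d)) (endingAt indeterminate y N (suc d)))
        (ℙ.+-cong (subst-upTo N (suc d)) (subst-endingAt N (suc d)))

      subst-endingAt N zero    = ℙ.refl
      subst-endingAt N (suc d) = ℙ.trans
        (subst-constant-* (recip (suc N ℕ.^ f d)) (P ℙ.+ indeterminate ℙ.* T))
        (ℙ.*-congˡ {y N d} (ℙ.trans (subst-+ P (indeterminate ℙ.* T))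
          (ℙ.+-cong (subst-upTo N d) (ℙ.trans (subst-indeterminate T) (ℙ.*-congˡ {q} (subst-endingAt N d))))))
        where
        P = upTo indeterminate y N d
        T = endingAt indeterminate y N d

open TruncatedZeta

-- Truncation of real polynomials, and the two determinants.

det-cong : ∀ {n} {M M′ : Fin n → Fin n → Poly} → (∀ i j → M i j ℙ.≈ M′ i j) → detᴾ M ℙ.≈ detᴾ M′
det-cong {zero}          M≈M′ = ℙ.refl
det-cong {suc n} {M} {M′} M≈M′ = sum-cong-≋ λ j → ℙ.*-congˡ {(ℙ.- ℙ.1#) ^ toℕ j}
  (ℙ.*-cong (M≈M′ zero j) (det-cong λ i k → M≈M′ (suc i) (punchIn j k)))
  where
  open CommutativeMonoidSum ℙ.+-commutativeMonoid using (sum-cong-≋)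
  open RawSemiringDefinitions (RawRing.rawSemiring ℙ.rawRing) using (_^_)

term : ℕ → ℝ → ℚ
term N x = seq x N

term-hom : ∀ N → StrictHomomorphism ℝ-rawRing (CommutativeRing.rawRing ℚ.+-*-commutativeRing) (term N)
term-hom N = record
  { +-hom   = λ _ _ → ≡.refl
  ; *-hom   = λ _ _ → ≡.refl
  ; neg-hom = λ _ → ≡.refl
  ; 0-hom   = ≡.refl
  ; 1-hom   = ≡.refl
  }

truncate : ℕ → ℝ[t]-Carrier → Poly
truncate N = List.map (term N)

truncate-hom : ∀ N → StrictHomomorphism ℝ[t] ℙ.rawRing (truncate N)
truncate-hom N = record
  { +-hom   = map-add _ _ (term-hom N)
  ; *-hom   = map-mul _ _ (term-hom N)
  ; neg-hom = map-neg _ _ (term-hom N)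
  ; 0-hom   = ≡.refl
  ; 1-hom   = ≡.refl
  }

-- Agreement at every index is stronger than `_≈ℝ_`, so the threshold can be 0 and no limit is
-- taken.
≈-by-truncation : ∀ p q → (∀ N → truncate N p ℙ.≈ truncate N q) → p ≈ℝ[t] q
≈-by-truncation p q p≈q n ε ε>0 = 0 , λ N _ → ≡.subst (ℚ._< ε) (≡.sym (vanishing N)) ε>0
  where
  open ≡-Reasoning
  module ℝP = Polynomial ℝ-rawRing
  vanishing : ∀ N → ℚ.∣ seq (ℝP.coeff p n) N ℚ.- seq (ℝP.coeff q n) N ∣ ≡ 0ℚ
  vanishing N = begin
    ℚ.∣ seq (ℝP.coeff p n) N ℚ.- seq (ℝP.coeff q n) N ∣
      ≡⟨ ≡.cong₂ (λ x y → ℚ.∣ x ℚ.- y ∣) (coeff-hom _ (CommutativeRing.rawRing ℚ.+-*-commutativeRing) (term-hom N) p n)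
           (≡.trans (coeff-hom _ (CommutativeRing.rawRing ℚ.+-*-commutativeRing) (term-hom N) q n) (≡.sym (at (p≈q N) n))) ⟩
    ℚ.∣ coeff (truncate N p) n ℚ.- coeff (truncate N p) n ∣
      ≡⟨ ≡.cong ℚ.∣_∣ (ℚ.+-inverseʳ (coeff (truncate N p) n)) ⟩
    0ℚ ∎

1-t : Poly
1-t = 1ℚ ∷ ℚ.- 1ℚ ∷ []

t+[1-t]≈1 : indeterminate ℙ.+ 1-t ℙ.≈ ℙ.1#
t+[1-t]≈1 = coefficientwise λ { zero → ≡.refl ; (suc zero) → ≡.refl ; (suc (suc n)) → ≡.refl }

module _ (b : ℤ → ℕ) (b≥2 : ∀ p → 2 ≤ b p) (N : ℕ) where
  private
    b⁺ : ℕ → ℕ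
    b⁺ d = b (+ suc d)

  truncate-ζᵗ : ∀ r → truncate N (ζᵗ (arguments b b≥2 (suc r)) (arguments-admissible b b≥2 r)) ℙ.≈
                      upTo indeterminate (weight b⁺) N (suc r)
  truncate-ζᵗ r = ℙ.trans
    (ℙ.reflexive (List.map-tabulate {n = suc r} (λ j → mkℝ (ζ-partial k (toℕ j)) (ζ-partial-cauchy k k-adm (toℕ j))) (term N)))
    (truncated-ζ-upTo b⁺ N r)
    where
    k = arguments b b≥2 (suc r)
    k-adm = arguments-admissible b b≥2 r

  truncate-ζ¹⁻ᵗ : ∀ r → truncate N (ζ¹⁻ᵗ (arguments b b≥2 (suc r)) (arguments-admissible b b≥2 r)) ℙ.≈
                        upTo 1-t (weight b⁺) N (suc r)
  truncate-ζ¹⁻ᵗ r = begin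
    truncate N (ζ¹⁻ᵗ (arguments b b≥2 (suc r)) (arguments-admissible b b≥2 r))
      ≡⟨ map-compose _ _ (term-hom N) ζ (fromℚ 1ℚ ∷ fromℚ (ℚ.- 1ℚ) ∷ []) ⟩
    compose (truncate N ζ) 1-t
      ≈⟨ Substitution.subst-cong 1-t (truncate N ζ) (upTo indeterminate (weight b⁺) N (suc r)) (truncate-ζᵗ r) ⟩
    compose (upTo indeterminate (weight b⁺) N (suc r)) 1-t
      ≈⟨ subst-upTo b⁺ 1-t N (suc r) ⟩
    upTo 1-t (weight b⁺) N (suc r) ∎
    where
    open SetoidReasoning ℙ.setoid
    ζ = ζᵗ (arguments b b≥2 (suc r)) (arguments-admissible b b≥2 r)

  -- The conventions agree: no arguments give 1, the value of `upTo` at length 0, and a negative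
  -- number gives 0.
  truncate-entry : ∀ (Z : ∀ {r} (k : Vec ℕ (suc r)) → Admissible k → ℝ[t]-Carrier) t →
    (∀ r → truncate N (Z (arguments b b≥2 (suc r)) (arguments-admissible b b≥2 r)) ℙ.≈ upTo t (weight b⁺) N (suc r)) →
    ∀ m n → truncate N (entry b b≥2 Z (m ℤ.⊖ n)) ℙ.≈ at-difference (upTo t (weight b⁺) N) m n
  truncate-entry Z t Z≈ zero    zero    = ℙ.refl
  truncate-entry Z t Z≈ (suc m) zero    = Z≈ m
  truncate-entry Z t Z≈ zero    (suc n) = ℙ.refl
  truncate-entry Z t Z≈ (suc m) (suc n) = ℙ.trans
    (ℙ.reflexive (≡.cong (truncate N ∘ entry b b≥2 Z) (ℤ.[1+m]⊖[1+n]≡m⊖n m n))) (truncate-entry Z t Z≈ m n)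

upTo-cong : ∀ t {y y′ : ℕ → ℕ → Poly} → (∀ N d → y N d ≡ y′ N d) → ∀ N d → upTo t y N d ≡ upTo t y′ N d
endingAt-cong : ∀ t {y y′ : ℕ → ℕ → Poly} → (∀ N d → y N d ≡ y′ N d) → ∀ N d → endingAt t y N d ≡ endingAt t y′ N d
upTo-cong t y≡ N       zero    = ≡.refl
upTo-cong t y≡ zero    (suc d) = ≡.refl
upTo-cong t y≡ (suc N) (suc d) = ≡.cong₂ ℙ._+_ (upTo-cong t y≡ N (suc d)) (endingAt-cong t y≡ N (suc d))
endingAt-cong t y≡ N zero    = ≡.refl
endingAt-cong t y≡ N (suc d) = ≡.cong₂ ℙ._*_ (y≡ N d)
  (≡.cong₂ (λ p q → p ℙ.+ t ℙ.* q) (upTo-cong t y≡ N d) (endingAt-cong t y≡ N d))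

at-difference-cong : ∀ {f g : ℕ → Poly} → (∀ d → f d ≡ g d) → ∀ m n → at-difference f m n ≡ at-difference g m n
at-difference-cong f≡g m       zero    = f≡g m
at-difference-cong f≡g zero    (suc n) = ≡.refl
at-difference-cong f≡g (suc m) (suc n) = at-difference-cong f≡g m n

open import Data.Integer.Base using (_+_; _-_)

theorem1p2 : (a : ℤ → ℕ) (a≥2 : ∀ j → 2 ≤ a j) (μ : Partition) → let open Partition μ in
    det (λ (i j : Fin height) →
    entry (λ p → a (p - index j)) (λ p → a≥2 (p - index j)) ζ¹⁻ᵗ
    (+ lookup parts i + index j - index i))
    ≈ℝ[t]
    det (λ (i j : Fin width) →
    entry (λ p → a (index j - p)) (λ p → a≥2 (index j - p)) ζᵗ
    (+ lookup conjugate i + index j - index i))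
theorem1p2 a a≥2 μ = ≈-by-truncation (det L) (det R) λ N → begin
  truncate N (det L)                                   ≡⟨ det-hom ℝ[t] ℙ.rawRing (truncate-hom N) L ⟩
  detᴾ (λ i k → truncate N (L i k))                    ≈⟨ det-cong (L-entry N) ⟩
  -- The left determinant uses the last `h` of the `n` covectors and the vertical steps; the right
  -- one uses the first `w` covectors of the inverse and the horizontal steps.
  detᴾ (λ i k → u N (w ℕ.+ toℕ k) (s i))
    ≈⟨ complementary-minors (u N) (e N) (ē N) (u-diagonal N) (u-triangular N) (pairing-self N) (pairing-orthogonal N)
         (λ j → ē≈e N j) (≡.sym length≡) (rows 0) columns ⟩
  detᴾ (λ i k → ē N (countdown w k) (r i))             ≈⟨ det-cong (R-entry N) ⟨
  detᴾ (λ i k → truncate N (R i k))                    ≡⟨ det-hom ℝ[t] ℙ.rawRing (truncate-hom N) R ⟨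
  truncate N (det R)                                   ∎
  where
  open SetoidReasoning ℙ.setoid
  open Partition μ
  open BoundaryWord (boundary-word width parts (width-linked μ))
  h = height
  w = width
  n = length

  L : Fin h → Fin h → ℝ[t]-Carrier
  L i j = entry (λ p → a (p - index j)) (λ p → a≥2 (p - index j)) ζ¹⁻ᵗ (+ lookup parts i + index j - index i)

  R : Fin w → Fin w → ℝ[t]-Carrier
  R i j = entry (λ p → a (index j - p)) (λ p → a≥2 (index j - p)) ζᵗ (+ lookup conjugate i + index j - index i)

  s : Fin h → ℕ
  s i = w ℕ.∸ lookup parts i ℕ.+ toℕ i

  r : Fin w → ℕ
  r i = h ℕ.∸ conjugate-part parts (toℕ i) ℕ.+ toℕ i

  -- Boundary positions count from the upper right end. With this choice `position (s i)` is λᵢ - i,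
  -- the index of the last argument in row i, and `position (w + k)` + 1 is -k, the index of the
  -- first argument in the column that `index` numbers k + 1.
  position : ℕ → ℤ
  position k = + w - + suc k

  y y′ : ℕ → ℕ → ℕ → Poly
  y  j = weight λ d → a (position j - + d)
  y′ i = weight λ d → a (+ suc d + position i)

  module Solve = ℤ.+-*-Solver

  y≡x : ∀ j N d {k} → k ≡ j ℕ.+ d → y j N d ≡ constant (recip (suc N ℕ.^ a (position k)))
  y≡x j N d ≡.refl = ≡.cong (λ p → constant (recip (suc N ℕ.^ a p)))
    (Solve.solve 3 (λ w j d → w :- (con (+ 1) :+ j) :- d := w :- (con (+ 1) :+ (j :+ d))) ≡.refl (+ w) (+ j) (+ d))
    where open Solve using (_:=_; _:+_; _:-_; con)

  y′≡x : ∀ i N d {k} → i ≡ k ℕ.+ suc d → y′ i N d ≡ constant (recip (suc N ℕ.^ a (position k)))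
  y′≡x i N d {k} ≡.refl = ≡.cong (λ p → constant (recip (suc N ℕ.^ a p)))
    (Solve.solve 3 (λ w k d → (con (+ 1) :+ d) :+ (w :- (con (+ 1) :+ (k :+ (con (+ 1) :+ d)))) := w :- (con (+ 1) :+ k)) ≡.refl (+ w) (+ k) (+ d))
    where open Solve using (_:=_; _:+_; _:-_; con)

  -- u N i k truncates ζ¹⁻ᵗ(a (position i + 1), …, a (position k)), and e N j k
  -- truncates ζᵗ(a (position j), …, a (position k + 1)).
  open Duality indeterminate 1-t t+[1-t]≈1 (λ N k → constant (recip (suc N ℕ.^ a (position k)))) y y′
    (λ j N d eq → ℙ.reflexive (y≡x j N d eq)) (λ i N d eq → ℙ.reflexive (y′≡x i N d eq))

  -- Column positions are enumerated from the lower left end, hence the reflected coordinate.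
  ē : ℕ → ℕ → ℕ → Poly
  ē N j x = e N j (n ℕ.∸ suc x)

  ē≈e : ∀ N j {i x} → i ℕ.+ suc x ≡ n → ē N j i ℙ.≈ e N j x
  ē≈e N j {i} {x} eq = ℙ.reflexive (≡.cong (e N j)
    (≡.trans (≡.cong (ℕ._∸ suc i) (≡.trans (≡.sym eq) (ℕ.+-suc i x))) (ℕ.m+n∸m≡n i x)))

  L-entry : ∀ N i k → truncate N (L i k) ℙ.≈ u N (w ℕ.+ toℕ k) (s i)
  L-entry N i k = begin
    truncate N (L i k)
      ≡⟨ ≡.cong (truncate N ∘ entry b b≥2 ζ¹⁻ᵗ) (≡.trans difference (ℤ.m-n≡m⊖n (w ℕ.+ toℕ k) (s i))) ⟩
    truncate N (entry b b≥2 ζ¹⁻ᵗ ((w ℕ.+ toℕ k) ℤ.⊖ s i))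
      ≈⟨ truncate-entry b b≥2 N ζ¹⁻ᵗ 1-t (truncate-ζ¹⁻ᵗ b b≥2 N) (w ℕ.+ toℕ k) (s i) ⟩
    at-difference (upTo 1-t (weight (b ∘ +_ ∘ suc)) N) (w ℕ.+ toℕ k) (s i)
      ≡⟨ at-difference-cong (upTo-cong 1-t (λ N d → ≡.cong (λ p → constant (recip (suc N ℕ.^ a p))) (shifted d)) N)
           (w ℕ.+ toℕ k) (s i) ⟩
    u N (w ℕ.+ toℕ k) (s i) ∎
    where
    open Solve using (_:=_; _:+_; _:-_; con)
    b : ℤ → ℕ
    b p = a (p - index k)
    b≥2 : ∀ p → 2 ≤ b p
    b≥2 p = a≥2 (p - index k)
    λᵢ = lookup parts i
    c = w ℕ.∸ λᵢ

    -- Over the integers the truncated subtraction `c` is opaque to the solver, so `w` is first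
    -- written as `c` + λᵢ.
    difference : + λᵢ + index k - index i ≡ + (w ℕ.+ toℕ k) - + s i
    difference = ≡.trans
      (Solve.solve 4 (λ l c k i → l :+ (con (+ 1) :+ k) :- (con (+ 1) :+ i) := (c :+ l) :+ k :- (c :+ i)) ≡.refl
        (+ λᵢ) (+ c) (+ toℕ k) (+ toℕ i))
      (≡.cong (λ w → + (w ℕ.+ toℕ k) - + s i) (ℕ.m∸n+n≡m (lookup-≤ (width-linked μ) i)))

    shifted : ∀ d → + suc d - index k ≡ + suc d + position (w ℕ.+ toℕ k)
    shifted d = Solve.solve 3 (λ d k w → (con (+ 1) :+ d) :- (con (+ 1) :+ k) := (con (+ 1) :+ d) :+ (w :- (con (+ 1) :+ (w :+ k))))
      ≡.refl (+ d) (+ toℕ k) (+ w)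

  R-entry : ∀ N i k → truncate N (R i k) ℙ.≈ ē N (countdown w k) (r i)
  R-entry N i k = begin
    truncate N (R i k)
      ≡⟨ ≡.cong (truncate N ∘ entry b b≥2 ζᵗ) (≡.trans difference (ℤ.m-n≡m⊖n x j)) ⟩
    truncate N (entry b b≥2 ζᵗ (x ℤ.⊖ j))
      ≈⟨ truncate-entry b b≥2 N ζᵗ indeterminate (truncate-ζᵗ b b≥2 N) x j ⟩
    at-difference (upTo indeterminate (weight (b ∘ +_ ∘ suc)) N) x j
      ≡⟨ at-difference-cong (upTo-cong indeterminate (λ N d → ≡.cong (λ p → constant (recip (suc N ℕ.^ a p))) (shifted d)) N) x j ⟩
    ē N j (r i) ∎
    where
    open Solve using (_:=_; _:+_; _:-_; con)
    b : ℤ → ℕ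
    b p = a (index k - p)
    b≥2 : ∀ p → 2 ≤ b p
    b≥2 p = a≥2 (index k - p)
    j = countdown w k
    x = n ℕ.∸ suc (r i)
    λ′ᵢ = conjugate-part parts (toℕ i)
    c = h ℕ.∸ λ′ᵢ

    k+1+j≡w : ∀ {w} (k : Fin w) → toℕ k ℕ.+ suc (countdown w k) ≡ w
    k+1+j≡w zero    = ≡.refl
    k+1+j≡w (suc k) = ≡.cong suc (k+1+j≡w k)

    -- Both sides equal n = w + h; the equation trades the truncated subtractions in `x` and `c` for
    -- sums that the solver can handle.
    total : x ℕ.+ suc (r i) ≡ (toℕ k ℕ.+ suc j) ℕ.+ (c ℕ.+ λ′ᵢ)
    total = ≡.trans (ℕ.m∸n+n≡m r<n)
      (≡.trans length≡ (≡.sym (≡.cong₂ ℕ._+_ (k+1+j≡w k) (ℕ.m∸n+n≡m (Vec.count≤n (suc (toℕ i) ℕ.≤?_) parts)))))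
      where
      r<n : suc (r i) ≤ n
      r<n = ℕ.≤-trans (ℕ.+-mono-≤-< (ℕ.m∸n≤m h λ′ᵢ) (Fin.toℕ<n i))
        (ℕ.≤-reflexive (≡.trans (ℕ.+-comm h w) (≡.sym length≡)))

    difference : + lookup conjugate i + index k - index i ≡ + x - + j
    difference = ≡.trans (≡.cong (λ l → + l + index k - index i) (Vec.lookup∘tabulate (λ i → conjugate-part parts (toℕ i)) i))
      (≡.trans
        (Solve.solve 5 (λ l k i j c → l :+ (con (+ 1) :+ k) :- (con (+ 1) :+ i) :=
                                      ((k :+ (con (+ 1) :+ j)) :+ (c :+ l)) :- (con (+ 1) :+ (c :+ i)) :- j) ≡.refl
          (+ λ′ᵢ) (+ toℕ k) (+ toℕ i) (+ j) (+ c))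
        (≡.trans (≡.cong (λ z → + z - + suc (r i) - + j) (≡.sym total))
          (Solve.solve 3 (λ x r j → (x :+ (con (+ 1) :+ r)) :- (con (+ 1) :+ r) :- j := x :- j) ≡.refl (+ x) (+ r i) (+ j))))

    shifted : ∀ d → index k - + suc d ≡ position j - + d
    shifted d = ≡.trans
      (Solve.solve 3 (λ k d j → (con (+ 1) :+ k) :- (con (+ 1) :+ d) := (k :+ (con (+ 1) :+ j)) :- (con (+ 1) :+ j) :- d)
        ≡.refl (+ toℕ k) (+ d) (+ j))
      (≡.cong (λ w → + w - + suc j - + d) (k+1+j≡w k))
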